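{- Tabularity in $\mathsf{NExt}(\mathsf{S4.3}_t)$ is decidable: given any formula $\phi$, it is decidable whether $\mathsf{S4.3}_t\oplus\phi$ is tabular.
   Context: Tense formulas use $\Box$ (future necessity) and a past possibility operator written here $\mathsf{P}$; $\mathsf{S4}_t=\mathsf{K}_t\oplus\{\Box p\to p,\Box p\to\Box\Box p\}$; $\mathsf{S4.3}_t$ is the tense logic of all reflexive transitive linear frames; $\mathsf{NExt}(L)$ is the set of all tense logics extending $L$; a logic is tabular if it is the logic of a single finite frame. -}

module Defs where

open import Level using (Level; 0ℓ) renaming (suc to lsuc)
open import Data.Nat using (ℕ)
open import Data.Fin using (Fin)
open import Data.Bool using (Bool; T)
open import Data.Product using (Σ; _×_; ∃-syntax)
open import Data.Empty using (⊥)
open import Relation.Nullary using (¬_)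
open import Function.Bundles using (_⇔_)

data Fm : Set where
  var  : ℕ → Fm
  ⊥′   : Fm
  _⇒_  : Fm → Fm → Fm
  □    : Fm → Fm
  𝐏    : Fm → Fm

infixr 5 _⇒_

¬′ : Fm → Fm
¬′ φ = φ ⇒ ⊥′

𝐇 : Fm → Fm
𝐇 φ = ¬′ (𝐏 (¬′ φ))

sub : (ℕ → Fm) → Fm → Fm
sub σ (var i)  = σ i
sub σ ⊥′       = ⊥′
sub σ (φ ⇒ ψ)  = sub σ φ ⇒ sub σ ψ
sub σ (□ φ)    = □ (sub σ φ)
sub σ (𝐏 φ)    = 𝐏 (sub σ φ)

-- Kripke frames and classical satisfaction.  Valuations are Bool-valued
-- and existential/disjunctive clauses are given in negative form, so that
-- every satisfaction statement is ¬¬-stable: this is exactly classical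
-- Kripke semantics rendered constructively.
record Frame : Set₁ where
  field
    W : Set
    R : W → W → Set
open Frame public

Valuation : Frame → Set
Valuation F = ℕ → W F → Bool

sat : (F : Frame) → Valuation F → W F → Fm → Set
sat F V w (var i)  = T (V i w)
sat F V w ⊥′       = ⊥
sat F V w (φ ⇒ ψ)  = sat F V w φ → sat F V w ψ
sat F V w (□ φ)    = ∀ v → R F w v → sat F V v φ
sat F V w (𝐏 φ)    = ¬ (∀ v → R F v w → ¬ sat F V v φ)

ValidIn : Frame → Fm → Set
ValidIn F φ = (V : Valuation F) (w : W F) → sat F V w φ

Reflexive : Frame → Set
Reflexive F = ∀ x → R F x x

Transitive : Frame → Set
Transitive F = ∀ x y z → R F x y → R F y z → R F x z

Linear : Frame → Set
Linear F = ∀ x y → ¬ (¬ R F x y × ¬ R F y x)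

S4·3t : Fm → Set₁
S4·3t φ = (F : Frame) → Reflexive F → Transitive F → Linear F → ValidIn F φ

-- S4.3_t ⊕ φ : the smallest normal tense logic containing S4.3_t and φ
-- (closure under modus ponens, both necessitation rules and uniform
-- substitution; S4.3_t already contains all tautologies and K_t axioms).
data S4·3t⊕_⊢_ (φ : Fm) : Fm → Set₁ where
  base  : ∀ {ψ} → S4·3t ψ → S4·3t⊕ φ ⊢ ψ
  ax    : S4·3t⊕ φ ⊢ φ
  mp    : ∀ {ψ χ} → S4·3t⊕ φ ⊢ (ψ ⇒ χ) → S4·3t⊕ φ ⊢ ψ → S4·3t⊕ φ ⊢ χ
  necG  : ∀ {ψ} → S4·3t⊕ φ ⊢ ψ → S4·3t⊕ φ ⊢ □ ψ
  necH  : ∀ {ψ} → S4·3t⊕ φ ⊢ ψ → S4·3t⊕ φ ⊢ 𝐇 ψ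
  usub  : ∀ {ψ} (σ : ℕ → Fm) → S4·3t⊕ φ ⊢ ψ → S4·3t⊕ φ ⊢ sub σ ψ

FinFrame : (n : ℕ) → (Fin n → Fin n → Set) → Frame
FinFrame n r = record { W = Fin n ; R = r }

Tabular : (Fm → Set₁) → Set₁
Tabular L = ∃[ n ] ∃[ r ] (∀ ψ → L ψ ⇔ ValidIn (FinFrame n r) ψ)

{-# OPTIONS --safe #-}
module Submission where

-- In a linear frame □ γ ∧ 𝐇 γ says that γ holds everywhere, so ψ is derivable
-- from φ as soon as finitely many substitution instances of φ, true throughout
-- an S4.3 model, force ψ to be true throughout it.
--
-- Tabularity is tested on five families of finite frames: chains, and clusters
-- with an optional extra point below and an optional extra point above.  If φ is
-- valid in one of the families the logic has models with arbitrarily many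
-- points and is not tabular.  Deleting inessential points shows that a family
-- refuting φ does so at a member of size bounded by the number of modalities
-- of φ, so this is decidable.
--
-- If all five families refute φ, then in a model of enough instances of φ any set
-- of points pairwise distinguishable at modal depth d is bounded in size by a
-- constant: a larger one would yield a definable p-morphism onto a member of a
-- family refuting φ.  Hence indistinguishability stabilizes at a bounded depth, and
-- the quotient is a small linear frame, on which every set is definable, so that it
-- validates φ.  The logic is therefore that of the disjoint union of all small
-- linear frames validating φ.
--
-- Satisfaction is ¬¬-stable, so the semantic arguments are classical ones carried
-- out in the double-negation monad.

open import Defs
open import Data.Bool using (Bool; if_then_else_; true; false; T; T?)
open import Data.Empty using (⊥; ⊥-elim)
open import Data.Fin using (Fin; zero; suc; toℕ; punchIn; splitAt; _↑ˡ_; _↑ʳ_; inject≤; fromℕ<)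
open import Data.Fin.Properties using (all?; any?; pigeonhole; punchIn-punchOut;
  punchIn-mono-≤; punchIn-cancel-≤; splitAt-↑ˡ; splitAt-↑ʳ; splitAt⁻¹-↑ˡ;
  splitAt⁻¹-↑ʳ; toℕ-injective; toℕ<n; toℕ-fromℕ<; inject≤-injective) renaming (_≟_ to _≟ᶠ_; <⇒≢ to <⇒≢ᶠ)
open import Data.List as List using (List; []; _∷_; _++_; length; map;
  concatMap; cartesianProductWith; upTo; foldr; filter)
open import Data.List.Membership.Propositional using (_∈_; _∉_)
open import Data.List.Membership.Propositional.Properties using (∈-cartesianProductWith⁺; ∈-++⁺ˡ;
  ∈-++⁺ʳ; ∈-map⁺; ∈-upTo⁺; ∈-concat⁺′; ∈-lookup; ∈-filter⁺)
open import Data.List.Properties using (length-++)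
open import Data.List.Relation.Binary.Sublist.Propositional using (_⊆_; []; _∷_; _∷ʳ_; ⊆-trans)
open import Data.List.Relation.Binary.Sublist.Propositional.Properties using (All-resp-⊆)
open import Data.List.Relation.Unary.All as All using (All; []; _∷_)
open import Data.List.Relation.Unary.All.Properties using (map⁺; all-filter)
open import Data.List.Relation.Unary.AllPairs as AllPairs using (AllPairs; []; _∷_)
open import Data.List.Relation.Unary.Any as Any using (Any; here; there)
open import Data.List.Relation.Unary.Any.Properties using (lookup-index)
open import Data.Nat using (ℕ; zero; suc; _+_; _*_; _⊔_; _≤_; _<_; _≤ᵇ_; z≤n; s≤s)
open import Data.Nat.Properties
open import Data.Product using (Σ; ∃-syntax; _×_; _,_; proj₁; proj₂)
open import Data.Sum using (_⊎_; inj₁; inj₂; [_,_]′)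
open import Data.Unit using (⊤; tt)
open import Data.Vec using (Vec; []; _∷_; lookup; tabulate; replicate)
open import Data.Vec.Properties using (lookup∘tabulate)
open import Function using (_∘_; id; case_of_)
open import Function.Bundles using (_⇔_; mk⇔; Equivalence)
open import Function.Construct.Composition using (_⇔-∘_)
open import Function.Construct.Identity using (⇔-id)
open import Function.Construct.Symmetry using (⇔-sym)
open import Relation.Binary.PropositionalEquality using (_≡_; _≢_; refl; sym; trans; cong; cong₂; subst)
open import Relation.Nullary using (¬_; Dec; yes; no; ¬?; _×-dec_; _→-dec_; ⌊_⌋; map′; 
  toWitness; fromWitness; contradiction)
open import Relation.Nullary.Negation using (¬¬-map; negated-stable)
open import Relation.Nullary.Decidable using (decidable-stable)

open Equivalence using (to; from)

-- Classical reasoning in the double-negation monad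

infixl 1 _>>=_

_>>=_ : {A B : Set} → ¬ ¬ A → (A → ¬ ¬ B) → ¬ ¬ B
(m >>= f) k = m λ a → f a k

return : {A : Set} → A → ¬ ¬ A
return a k = k a

excluded-middle : (A : Set) → ¬ ¬ Dec A
excluded-middle A k = k (no (k ∘ yes))

¬¬-choice : ∀ {n} {P : Fin n → Set} → (∀ i → ¬ ¬ P i) → ¬ ¬ (∀ i → P i)
¬¬-choice {zero}  f = return λ ()
¬¬-choice {suc n} f = do
  p  ← f zero
  ps ← ¬¬-choice (f ∘ suc)
  return λ { zero → p ; (suc i) → ps i }

¬¬-All : {A : Set} {P : A → Set} → (∀ a → ¬ ¬ P a) → ∀ as → ¬ ¬ All P as
¬¬-All f []       = return []
¬¬-All f (a ∷ as) = do
  p  ← f a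
  ps ← ¬¬-All f as
  return (p ∷ ps)

-- Valuations are Boolean and `𝐏` is read as a negation, so stability passes through every
-- connective. This is what turns a semantic argument carried out in the monad back into plain
-- truth.
sat-stable : ∀ F V w φ → ¬ ¬ sat F V w φ → sat F V w φ
sat-stable F V w (var i) ¬¬s = decidable-stable (T? (V i w)) ¬¬s
sat-stable F V w ⊥′      ¬¬s = ¬¬s id
sat-stable F V w (φ ⇒ ψ) ¬¬s p = sat-stable F V w ψ λ k → ¬¬s λ f → k (f p)
sat-stable F V w (□ φ)   ¬¬s v r = sat-stable F V v φ λ k → ¬¬s λ f → k (f v r)
sat-stable F V w (𝐏 φ)   ¬¬s k = ¬¬s λ p → p k

-- Variables, substitution and bisimulation

_occursIn_ : ℕ → Fm → Set
i occursIn var j   = i ≡ j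
i occursIn ⊥′      = ⊥
i occursIn (φ ⇒ ψ) = i occursIn φ ⊎ i occursIn ψ
i occursIn □ φ     = i occursIn φ
i occursIn 𝐏 φ     = i occursIn φ

varBound : Fm → ℕ
varBound (var i) = suc i
varBound ⊥′      = 0
varBound (φ ⇒ ψ) = varBound φ ⊔ varBound ψ
varBound (□ φ)   = varBound φ
varBound (𝐏 φ)   = varBound φ

occursIn⇒< : ∀ {i} φ → i occursIn φ → i < varBound φ
occursIn⇒< (var i) refl     = ≤-refl
occursIn⇒< (φ ⇒ ψ) (inj₁ o) = ≤-trans (occursIn⇒< φ o) (m≤m⊔n _ _)
occursIn⇒< (φ ⇒ ψ) (inj₂ o) = ≤-trans (occursIn⇒< ψ o) (m≤n⊔m (varBound φ) _)
occursIn⇒< (□ φ)   o        = occursIn⇒< φ o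
occursIn⇒< (𝐏 φ)   o        = occursIn⇒< φ o

sub-var : ∀ φ → sub var φ ≡ φ
sub-var (var i) = refl
sub-var ⊥′      = refl
sub-var (φ ⇒ ψ) = cong₂ _⇒_ (sub-var φ) (sub-var ψ)
sub-var (□ φ)   = cong □ (sub-var φ)
sub-var (𝐏 φ)   = cong 𝐏 (sub-var φ)

record Bisimulation (F G : Frame) (Z : W F → W G → Set) : Set where
  field
    forth  : ∀ {x y x′} → Z x y → R F x x′ → ¬ ¬ (∃[ y′ ] R G y y′ × Z x′ y′)
    back   : ∀ {x y y′} → Z x y → R G y y′ → ¬ ¬ (∃[ x′ ] R F x x′ × Z x′ y′)
    forth⁻ : ∀ {x y x′} → Z x y → R F x′ x → ¬ ¬ (∃[ y′ ] R G y′ y × Z x′ y′)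
    back⁻  : ∀ {x y y′} → Z x y → R G y′ y → ¬ ¬ (∃[ x′ ] R F x′ x × Z x′ y′)

-- Taking a substitution on one side makes the same induction serve
-- substitution lemmas, p-morphisms and invariance under bisimulation.
bisimulation-sub : ∀ {F G Z} → Bisimulation F G Z → ∀ {V V′ σ} φ →
  (∀ {i x y} → i occursIn φ → Z x y → sat F V x (σ i) ⇔ T (V′ i y)) →
  ∀ {x y} → Z x y → sat F V x (sub σ φ) ⇔ sat G V′ y φ
bisimulation-sub bis (var i) atoms z = atoms refl z
bisimulation-sub bis ⊥′ atoms z = ⇔-id _
bisimulation-sub bis (φ ⇒ ψ) atoms z = mk⇔
  (λ f p → to IHψ (f (from IHφ p)))
  (λ f p → from IHψ (f (to IHφ p)))
  where
  IHφ = bisimulation-sub bis φ (atoms ∘ inj₁) z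
  IHψ = bisimulation-sub bis ψ (atoms ∘ inj₂) z
bisimulation-sub {F} {G} bis {V} {V′} {σ} (□ φ) atoms z = mk⇔
  (λ f y r → sat-stable G V′ y φ λ k →
    back z r λ (x , r′ , z′) → k (to (bisimulation-sub bis φ atoms z′) (f x r′)))
  (λ f x r → sat-stable F V x (sub σ φ) λ k →
    forth z r λ (y , r′ , z′) → k (from (bisimulation-sub bis φ atoms z′) (f y r′)))
  where open Bisimulation bis
bisimulation-sub bis (𝐏 φ) atoms z = mk⇔
  (λ p k → p λ x r s → forth⁻ z r λ (y , r′ , z′) →
    k y r′ (to (bisimulation-sub bis φ atoms z′) s))
  (λ p k → p λ y r s → back⁻ z r λ (x , r′ , z′) →
    k x r′ (from (bisimulation-sub bis φ atoms z′) s))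
  where open Bisimulation bis

bisimulation-invariance : ∀ {F G Z} → Bisimulation F G Z → ∀ {V V′} φ →
  (∀ {i x y} → i occursIn φ → Z x y → T (V i x) ⇔ T (V′ i y)) →
  ∀ {x y} → Z x y → sat F V x φ ⇔ sat G V′ y φ
bisimulation-invariance {F} {G} bis {V} {V′} φ atoms {x} {y} z =
  subst (λ χ → sat F V x χ ⇔ sat G V′ y φ) (sub-var φ)
    (bisimulation-sub bis {σ = var} φ atoms z)

≡-bisimulation : ∀ F → Bisimulation F F _≡_
≡-bisimulation F = record
  { forth  = λ { refl r → return (_ , r , refl) }
  ; back   = λ { refl r → return (_ , r , refl) }
  ; forth⁻ = λ { refl r → return (_ , r , refl) }
  ; back⁻  = λ { refl r → return (_ , r , refl) }
  }

-- Deciding truth and validity in finite frames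

boolFrame : ∀ n → (Fin n → Fin n → Bool) → Frame
boolFrame n r = FinFrame n λ i j → T (r i j)

sat? : ∀ {n} r V w φ → Dec (sat (boolFrame n r) V w φ)
sat? r V w (var i) = T? (V i w)
sat? r V w ⊥′      = no id
sat? r V w (φ ⇒ ψ) = sat? r V w φ →-dec sat? r V w ψ
sat? r V w (□ φ)   = all? λ v → T? (r w v) →-dec sat? r V v φ
sat? r V w (𝐏 φ)   = ¬? (all? λ v → T? (r v w) →-dec ¬? (sat? r V v φ))

vecs : {A : Set} → List A → ∀ n → List (Vec A n)
vecs as zero    = [] ∷ []
vecs as (suc n) = cartesianProductWith _∷_ as (vecs as n)

∈-vecs : {A : Set} {as : List A} → ∀ {n} (v : Vec A n) →
  (∀ i → lookup v i ∈ as) → v ∈ vecs as n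
∈-vecs []      ∈as = here refl
∈-vecs (a ∷ v) ∈as = ∈-cartesianProductWith⁺ _∷_ (∈as zero) (∈-vecs v (∈as ∘ suc))

bools : List Bool
bools = false ∷ true ∷ []

∈-bools : ∀ b → b ∈ bools
∈-bools false = here refl
∈-bools true  = there (here refl)

matrices : ∀ m n → List (Vec (Vec Bool n) m)
matrices m n = vecs (vecs bools n) m

∈-matrices : ∀ {m n} (M : Vec (Vec Bool n) m) → M ∈ matrices m n
∈-matrices M = ∈-vecs M λ i → ∈-vecs (lookup M i) (∈-bools ∘ lookup (lookup M i))

entry : ∀ {m n} → Vec (Vec Bool n) m → Fin m → Fin n → Bool
entry M i j = lookup (lookup M i) j

matrix : ∀ {m n} → (Fin m → Fin n → Bool) → Vec (Vec Bool n) m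
matrix r = tabulate λ i → tabulate (r i)

entry-matrix : ∀ {m n} (r : Fin m → Fin n → Bool) i j → entry (matrix r) i j ≡ r i j
entry-matrix r i j rewrite lookup∘tabulate (λ i → tabulate (r i)) i = lookup∘tabulate (r i) j

-- d is a junk value beyond the length of the vector.
index : {A : Set} → A → ∀ {k} → Vec A k → ℕ → A
index d []      i       = d
index d (a ∷ v) zero    = a
index d (a ∷ v) (suc i) = index d v i

index-toℕ : {A : Set} (d : A) → ∀ {k} (v : Vec A k) i → index d v (toℕ i) ≡ lookup v i
index-toℕ d (a ∷ v) zero    = refl
index-toℕ d (a ∷ v) (suc i) = index-toℕ d v i

index-tabulate : {A : Set} (d : A) → ∀ {k} (f : ℕ → A) {i} → i < k →
  index d (tabulate {n = k} (f ∘ toℕ)) i ≡ f i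
index-tabulate d {suc k} f {zero}  i<k       = refl
index-tabulate d {suc k} f {suc i} (s≤s i<k) = index-tabulate d (f ∘ suc) i<k

valuation : ∀ {k n} → Vec (Vec Bool n) k → ℕ → Fin n → Bool
valuation {n = n} M i = lookup (index (replicate n false) M i)

valuation-matrix : ∀ {k n} (V : ℕ → Fin n → Bool) {i} j → i < k →
  valuation (matrix {k} (V ∘ toℕ)) i j ≡ V i j
valuation-matrix V j i<k =
  trans (cong (λ v → lookup v j) (index-tabulate _ (tabulate ∘ V) i<k))
        (lookup∘tabulate (V _) j)

if-true : ∀ {A : Set} {b} {x y : A} → T b → (if b then x else y) ≡ x
if-true {b = true} _ = refl

if-false : ∀ {A : Set} {b} {x y : A} → ¬ T b → (if b then x else y) ≡ y
if-false {b = true}  ¬b = contradiction tt ¬b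
if-false {b = false} _  = refl

≡⇒T⇔ : ∀ {b c} → b ≡ c → T b ⇔ T c
≡⇒T⇔ refl = ⇔-id _

-- Truth of φ depends only on the variables below `varBound φ`, so the valuations to be tested form
-- a finite list of matrices.
valid? : ∀ n r φ → Dec (ValidIn (boolFrame n r) φ)
valid? n r φ = map′
  (λ valid V w → to
    (bisimulation-invariance (≡-bisimulation _) φ
      (λ { {y = j} o refl → ≡⇒T⇔ (valuation-matrix V j (occursIn⇒< φ o)) }) refl)
    (All.lookup valid (∈-matrices (matrix (V ∘ toℕ))) w))
  (λ valid → All.tabulate λ {M} _ → valid (valuation M))
  (All.all? (λ M → all? λ w → sat? r (valuation M) w φ) (matrices (varBound φ) n))

-- S4.3 frames, soundness and semantic derivation

S4·3Frame : Frame → Set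
S4·3Frame F = Reflexive F × Transitive F × Linear F

S4·3Frame? : ∀ n r → Dec (S4·3Frame (boolFrame n r))
S4·3Frame? n r =
  (all? λ x → T? (r x x)) ×-dec
  (all? λ x → all? λ y → all? λ z → T? (r x y) →-dec T? (r y z) →-dec T? (r x z)) ×-dec
  (all? λ x → all? λ y → ¬? (¬? (T? (r x y)) ×-dec ¬? (T? (r y x))))

soundness : ∀ {φ ψ n r} → S4·3Frame (boolFrame n r) → ValidIn (boolFrame n r) φ →
  S4·3t⊕ φ ⊢ ψ → ValidIn (boolFrame n r) ψ
soundness (rfl , tra , lin) valid (base S4·3ψ) = S4·3ψ _ rfl tra lin
soundness F∈ valid ax            = valid
soundness F∈ valid (mp d e) V w  = soundness F∈ valid d V w (soundness F∈ valid e V w)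
soundness F∈ valid (necG d) V w  = λ v _ → soundness F∈ valid d V v
soundness F∈ valid (necH d) V w  = λ p → p λ v _ k → k (soundness F∈ valid d V v)
-- The substitution is absorbed into the valuation: variable i becomes the truth set of σ i, which
-- is Boolean because truth in a finite frame is decidable.
soundness {n = n} {r} F∈ valid (usub {ψ} σ d) V w = from
  (bisimulation-sub (≡-bisimulation _) {V′ = V′} ψ
    (λ { {i} {x} _ refl → mk⇔ fromWitness toWitness }) refl)
  (soundness F∈ valid d V′ w)
  where
  V′ : Valuation (boolFrame n r)
  V′ i x = ⌊ sat? r V x (σ i) ⌋

-- The formula behind a deduction theorem for global premises: each γ enters as □ γ and 𝐇 γ, which
-- necessitation provides once γ is derivable.
globally_imply_ : List Fm → Fm → Fm
globally Γ imply ψ = foldr (λ γ χ → □ γ ⇒ 𝐇 γ ⇒ χ) ψ Γ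

discharge : ∀ {φ ψ Γ} → All (S4·3t⊕ φ ⊢_) Γ →
  S4·3t⊕ φ ⊢ (globally Γ imply ψ) → S4·3t⊕ φ ⊢ ψ
discharge []       d = d
discharge (e ∷ es) d = discharge es (mp (mp d (necG e)) (necH e))

TrueIn : (F : Frame) → Valuation F → Fm → Set
TrueIn F V γ = ∀ w → sat F V w γ

sat-globally : ∀ {F V w ψ} → Linear F → ∀ Γ →
  (All (TrueIn F V) Γ → sat F V w ψ) → sat F V w (globally Γ imply ψ)
sat-globally lin [] f = f []
sat-globally {F} {V} {w} lin (γ ∷ Γ) f □γ 𝐇γ = sat-globally lin Γ λ Γ-true → f (γ-true ∷ Γ-true)
  where
  γ-true : TrueIn F V γ
  γ-true v = sat-stable F V v γ λ ¬γ →
    lin w v ((¬γ ∘ □γ v) , λ vRw → 𝐇γ λ k → k v vRw ¬γ)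

-- `base` accepts every formula valid on all S4.3 frames, so a semantic check of the global
-- implication is already a derivation of it.
derive : ∀ {φ ψ} Γ → All (S4·3t⊕ φ ⊢_) Γ →
  (∀ F → S4·3Frame F → ∀ V → All (TrueIn F V) Γ → TrueIn F V ψ) → S4·3t⊕ φ ⊢ ψ
derive Γ Γ⊢ sem = discharge Γ⊢ (base λ F rfl tra lin V w →
  sat-globally lin Γ λ Γ-true → sem F (rfl , tra , lin) V Γ-true w)

-- Disjoint unions of finite frames

module _ {m n : ℕ} (r : Fin m → Fin m → Bool) (s : Fin n → Fin n → Bool) where

  glue : Fin m ⊎ Fin n → Fin m ⊎ Fin n → Bool
  glue (inj₁ i) (inj₁ j) = r i j
  glue (inj₂ i) (inj₂ j) = s i j
  glue _        _        = false

  disjointUnion : Fin (m + n) → Fin (m + n) → Bool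
  disjointUnion x y = glue (splitAt m x) (splitAt m y)

  ↑ˡ-bisimulation : Bisimulation (boolFrame m r) (boolFrame (m + n) disjointUnion)
    (λ x y → y ≡ x ↑ˡ n)
  ↑ˡ-bisimulation = record { forth = forth ; back = back ; forth⁻ = forth⁻ ; back⁻ = back⁻ }
    where
    forth : ∀ {x y x′} → y ≡ x ↑ˡ n → T (r x x′) → _
    forth {x} {x′ = x′} refl xx′ = return (x′ ↑ˡ n , subst T (sym eq) xx′ , refl)
      where eq = cong₂ glue (splitAt-↑ˡ m x n) (splitAt-↑ˡ m x′ n)
    forth⁻ : ∀ {x y x′} → y ≡ x ↑ˡ n → T (r x′ x) → _
    forth⁻ {x} {x′ = x′} refl xx′ = return (x′ ↑ˡ n , subst T (sym eq) xx′ , refl)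
      where eq = cong₂ glue (splitAt-↑ˡ m x′ n) (splitAt-↑ˡ m x n)
    back : ∀ {x y y′} → y ≡ x ↑ˡ n → T (disjointUnion y y′) → _
    back {x} {y′ = y′} refl yy′ rewrite splitAt-↑ˡ m x n with splitAt m y′ in eq
    ... | inj₁ x′ = return (x′ , yy′ , sym (splitAt⁻¹-↑ˡ eq))
    back⁻ : ∀ {x y y′} → y ≡ x ↑ˡ n → T (disjointUnion y′ y) → _
    back⁻ {x} {y′ = y′} refl yy′ rewrite splitAt-↑ˡ m x n with splitAt m y′ in eq
    ... | inj₁ x′ = return (x′ , yy′ , sym (splitAt⁻¹-↑ˡ eq))

  ↑ʳ-bisimulation : Bisimulation (boolFrame n s) (boolFrame (m + n) disjointUnion)
    (λ x y → y ≡ m ↑ʳ x)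
  ↑ʳ-bisimulation = record { forth = forth ; back = back ; forth⁻ = forth⁻ ; back⁻ = back⁻ }
    where
    forth : ∀ {x y x′} → y ≡ m ↑ʳ x → T (s x x′) → _
    forth {x} {x′ = x′} refl xx′ = return (m ↑ʳ x′ , subst T (sym eq) xx′ , refl)
      where eq = cong₂ glue (splitAt-↑ʳ m n x) (splitAt-↑ʳ m n x′)
    forth⁻ : ∀ {x y x′} → y ≡ m ↑ʳ x → T (s x′ x) → _
    forth⁻ {x} {x′ = x′} refl xx′ = return (m ↑ʳ x′ , subst T (sym eq) xx′ , refl)
      where eq = cong₂ glue (splitAt-↑ʳ m n x′) (splitAt-↑ʳ m n x)
    back : ∀ {x y y′} → y ≡ m ↑ʳ x → T (disjointUnion y y′) → _
    back {x} {y′ = y′} refl yy′ rewrite splitAt-↑ʳ m n x with splitAt m y′ in eq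
    ... | inj₂ x′ = return (x′ , yy′ , sym (splitAt⁻¹-↑ʳ eq))
    back⁻ : ∀ {x y y′} → y ≡ m ↑ʳ x → T (disjointUnion y′ y) → _
    back⁻ {x} {y′ = y′} refl yy′ rewrite splitAt-↑ʳ m n x with splitAt m y′ in eq
    ... | inj₂ x′ = return (x′ , yy′ , sym (splitAt⁻¹-↑ʳ eq))

  -- Each component is bisimilar to its copy in the union; a valuation of one component is extended
  -- by `false` to the other.
  disjointUnion-valid : ∀ φ → ValidIn (boolFrame (m + n) disjointUnion) φ ⇔
    (ValidIn (boolFrame m r) φ × ValidIn (boolFrame n s) φ)
  disjointUnion-valid φ = mk⇔ (λ valid → left valid , right valid) (λ (vr , vs) → glued vr vs)
    where
    extend : (Fin m ⊎ Fin n → Bool) → Fin (m + n) → Bool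
    extend f y = f (splitAt m y)

    left : ValidIn (boolFrame (m + n) disjointUnion) φ → ValidIn (boolFrame m r) φ
    left valid V x = from
      (bisimulation-invariance ↑ˡ-bisimulation φ
        (λ { {i} {x} _ refl → ≡⇒T⇔ (sym (cong [ V i , (λ _ → false) ]′ (splitAt-↑ˡ m x n))) })
        refl)
      (valid (λ i → extend [ V i , (λ _ → false) ]′) (x ↑ˡ n))

    right : ValidIn (boolFrame (m + n) disjointUnion) φ → ValidIn (boolFrame n s) φ
    right valid V x = from
      (bisimulation-invariance ↑ʳ-bisimulation φ
        (λ { {i} {x} _ refl → ≡⇒T⇔ (sym (cong [ (λ _ → false) , V i ]′ (splitAt-↑ʳ m n x))) })
        refl)
      (valid (λ i → extend [ (λ _ → false) , V i ]′) (m ↑ʳ x))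

    glued : ValidIn (boolFrame m r) φ → ValidIn (boolFrame n s) φ →
      ValidIn (boolFrame (m + n) disjointUnion) φ
    glued vr vs V y with splitAt m y in eq
    ... | inj₁ x = to
      (bisimulation-invariance ↑ˡ-bisimulation {V′ = V} φ
        (λ { _ refl → ⇔-id _ }) (sym (splitAt⁻¹-↑ˡ eq)))
      (vr (λ i x → V i (x ↑ˡ n)) x)
    ... | inj₂ x = to
      (bisimulation-invariance ↑ʳ-bisimulation {V′ = V} φ
        (λ { _ refl → ⇔-id _ }) (sym (splitAt⁻¹-↑ʳ eq)))
      (vs (λ i x → V i (m ↑ʳ x)) x)

SquareMatrix : Set
SquareMatrix = Σ ℕ λ n → Vec (Vec Bool n) n

frameOf : SquareMatrix → Frame
frameOf (n , M) = boolFrame n (entry M)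

unionSize : List SquareMatrix → ℕ
unionSize []             = 0
unionSize ((n , _) ∷ Ms) = n + unionSize Ms

unionRel : ∀ Ms → Fin (unionSize Ms) → Fin (unionSize Ms) → Bool
unionRel ((n , M) ∷ Ms) = disjointUnion (entry M) (unionRel Ms)

union-valid : ∀ Ms φ → ValidIn (boolFrame (unionSize Ms) (unionRel Ms)) φ ⇔
  All (λ M → ValidIn (frameOf M) φ) Ms
union-valid [] φ = mk⇔ (λ _ → []) (λ { _ V () })
union-valid (M ∷ Ms) φ = mk⇔
  (λ valid → let v , vs = to glued valid in v ∷ to (union-valid Ms φ) vs)
  (λ { (v ∷ vs) → from glued (v , from (union-valid Ms φ) vs) })
  where glued = disjointUnion-valid (entry (proj₂ M)) (unionRel Ms) φ

-- Deleting points from finite linear models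

covering⇒long : ∀ {n} (xs : List (Fin n)) → (∀ p → p ∈ xs) → n ≤ length xs
covering⇒long xs ∈xs = ≮⇒≥ λ short →
  let i , j , i<j , eq = pigeonhole short (λ p → Any.index (∈xs p)) in
  <⇒≢ᶠ i<j (trans (lookup-index (∈xs i))
    (trans (cong (List.lookup xs) eq) (sym (lookup-index (∈xs j)))))

fresh-element : ∀ {n} (xs : List (Fin n)) → length xs < n → ∃[ p ] p ∉ xs
fresh-element xs short with any? (λ p → ¬? (Any.any? (p ≟ᶠ_) xs))
... | yes fresh = fresh
... | no ¬fresh = contradiction (covering⇒long xs λ p →
  decidable-stable (Any.any? (p ≟ᶠ_) xs) λ p∉ → ¬fresh (p , p∉)) (<⇒≱ short)

modalities : Fm → ℕ
modalities (var i) = 0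
modalities ⊥′      = 0
modalities (φ ⇒ ψ) = modalities φ + modalities ψ
modalities (□ φ)   = suc (modalities φ)
modalities (𝐏 φ)   = suc (modalities φ)

module _ {n : ℕ} {P : Fin n → Set} (P? : ∀ p → Dec (P p)) where

  witnesses : List (Fin n)
  witnesses with any? P?
  ... | yes (p , _) = p ∷ []
  ... | no _        = []

  length-witnesses : length witnesses ≤ 1
  length-witnesses with any? P?
  ... | yes _ = ≤-refl
  ... | no _  = z≤n

  unique⇒∈-witnesses : (∀ {p q} → P p → P q → p ≡ q) → ∀ {p} → P p → p ∈ witnesses
  unique⇒∈-witnesses unique Pp with any? P?
  ... | yes (_ , Pq) = here (unique Pp Pq)
  ... | no ¬∃        = contradiction (_ , Pp) ¬∃

-- In a linear model each modal subformula makes at most one point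
-- indispensable, namely a last failure of χ for □ χ or a first success of χ
-- for 𝐏 χ.  Every other point can be deleted.
module _ {n : ℕ} (r : Fin (suc n) → Fin (suc n) → Bool)
  (F∈S4·3 : S4·3Frame (boolFrame (suc n) r)) (V : Valuation (boolFrame (suc n) r)) where

  private
    _⊨_ : Fin (suc n) → Fm → Set
    x ⊨ χ = sat (boolFrame (suc n) r) V x χ

    transitive = proj₁ (proj₂ F∈S4·3)
    linear = proj₂ (proj₂ F∈S4·3)

  -- The condition is `y ≢ p`, not strict precedence: if a cluster contains two failures of χ,
  -- neither is a last failure, and either can be deleted while the other still refutes □ χ.
  LastFailure FirstSuccess : Fm → Fin (suc n) → Set
  LastFailure  χ p = ¬ p ⊨ χ × (∀ y → T (r p y) → y ≢ p → y ⊨ χ)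
  FirstSuccess χ p = p ⊨ χ × (∀ y → T (r y p) → y ≢ p → ¬ y ⊨ χ)

  lastFailure? : ∀ χ p → Dec (LastFailure χ p)
  lastFailure? χ p = ¬? (sat? r V p χ) ×-dec
    (all? λ y → T? (r p y) →-dec ¬? (y ≟ᶠ p) →-dec sat? r V y χ)

  firstSuccess? : ∀ χ p → Dec (FirstSuccess χ p)
  firstSuccess? χ p = sat? r V p χ ×-dec
    (all? λ y → T? (r y p) →-dec ¬? (y ≟ᶠ p) →-dec ¬? (sat? r V y χ))

  -- Two distinct such points would be comparable, and the condition at one would make χ true at the
  -- other, which it sees.
  lastFailure-unique : ∀ χ {p q} → LastFailure χ p → LastFailure χ q → p ≡ q
  lastFailure-unique χ {p} {q} (¬p , after-p) (¬q , after-q) =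
    decidable-stable (p ≟ᶠ q) λ p≢q → linear p q
      ((λ pq → ¬q (after-p q pq (p≢q ∘ sym))) , (λ qp → ¬p (after-q p qp p≢q)))

  firstSuccess-unique : ∀ χ {p q} → FirstSuccess χ p → FirstSuccess χ q → p ≡ q
  firstSuccess-unique χ {p} {q} (⊨p , before-p) (⊨q , before-q) =
    decidable-stable (p ≟ᶠ q) λ p≢q → linear p q
      ((λ pq → before-q p pq p≢q ⊨p) , (λ qp → before-p q qp (p≢q ∘ sym) ⊨q))

  critical : Fm → List (Fin (suc n))
  critical (var i) = []
  critical ⊥′      = []
  critical (φ ⇒ ψ) = critical φ ++ critical ψ
  critical (□ φ)   = witnesses (lastFailure? φ) ++ critical φ
  critical (𝐏 φ)   = witnesses (firstSuccess? φ) ++ critical φ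

  length-critical : ∀ φ → length (critical φ) ≤ modalities φ
  length-critical (var i) = z≤n
  length-critical ⊥′      = z≤n
  length-critical (φ ⇒ ψ) rewrite length-++ (critical φ) {critical ψ} =
    +-mono-≤ (length-critical φ) (length-critical ψ)
  length-critical (□ φ) rewrite length-++ (witnesses (lastFailure? φ)) {critical φ} =
    +-mono-≤ (length-witnesses (lastFailure? φ)) (length-critical φ)
  length-critical (𝐏 φ) rewrite length-++ (witnesses (firstSuccess? φ)) {critical φ} =
    +-mono-≤ (length-witnesses (firstSuccess? φ)) (length-critical φ)

  module _ (p : Fin (suc n)) where

    private
      _⊨ᵖ_ : Fin n → Fm → Set
      _⊨ᵖ_ = sat (boolFrame n λ x y → r (punchIn p x) (punchIn p y)) (λ i x → V i (punchIn p x))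

    punchIn-surjective : (P : Fin (suc n) → Set) → (∀ x → P (punchIn p x)) → ∀ y → y ≢ p → P y
    punchIn-surjective P all y y≢p = subst P (punchIn-punchOut (y≢p ∘ sym)) (all _)

    delete-noncritical : ∀ φ → p ∉ critical φ → ∀ x → punchIn p x ⊨ φ ⇔ x ⊨ᵖ φ
    delete-noncritical (var i) p∉ x = ⇔-id _
    delete-noncritical ⊥′      p∉ x = ⇔-id _
    delete-noncritical (φ ⇒ ψ) p∉ x = mk⇔
      (λ f s → to IHψ (f (from IHφ s)))
      (λ f s → from IHψ (f (to IHφ s)))
      where
      IHφ = delete-noncritical φ (p∉ ∘ ∈-++⁺ˡ) x
      IHψ = delete-noncritical ψ (p∉ ∘ ∈-++⁺ʳ (critical φ)) x
    delete-noncritical (□ φ) p∉ x = mk⇔ (λ f y xy → to (IH y) (f _ xy)) only-if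
      where
      IH = delete-noncritical φ (p∉ ∘ ∈-++⁺ʳ (witnesses (lastFailure? φ)))
      only-if : x ⊨ᵖ □ φ → punchIn p x ⊨ □ φ
      only-if f y xy with y ≟ᶠ p
      ... | no y≢p =
        punchIn-surjective (λ y → T (r (punchIn p x) y) → y ⊨ φ) (λ y → from (IH y) ∘ f y) y y≢p xy
      -- If φ failed at the deleted p, every other successor of p would be a remaining successor of
      -- x and satisfy φ. Then p would be the last failure, hence critical.
      ... | yes refl = decidable-stable (sat? r V p φ) λ ¬p → p∉ (∈-++⁺ˡ
        (unique⇒∈-witnesses (lastFailure? φ) (lastFailure-unique φ)
          (¬p , λ z pz z≢p → punchIn-surjective (λ z → T (r p z) → z ⊨ φ)
            (λ z pz → from (IH z) (f z (transitive _ _ _ xy pz))) z z≢p pz)))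
    delete-noncritical (𝐏 φ) p∉ x = mk⇔ if (λ s k → s λ y yx → k _ yx ∘ from (IH y))
      where
      IH = delete-noncritical φ (p∉ ∘ ∈-++⁺ʳ (witnesses (firstSuccess? φ)))
      if : punchIn p x ⊨ 𝐏 φ → x ⊨ᵖ 𝐏 φ
      if s k = s refute
        where
        refute : ∀ y → T (r y (punchIn p x)) → ¬ y ⊨ φ
        refute y yx with y ≟ᶠ p
        ... | no y≢p =
          punchIn-surjective (λ y → T (r y (punchIn p x)) → ¬ y ⊨ φ) (λ y yx → k y yx ∘ to (IH y)) y y≢p yx
        -- Dually, a success at p with none at the remaining predecessors of x would be a first
        -- success.
        ... | yes refl = λ ⊨p → p∉ (∈-++⁺ˡ
          (unique⇒∈-witnesses (firstSuccess? φ) (firstSuccess-unique φ)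
            (⊨p , λ z zp z≢p → punchIn-surjective (λ z → T (r z p) → ¬ z ⊨ φ)
              (λ z zp → k z (transitive _ _ _ zp yx) ∘ to (IH z)) z z≢p zp)))

-- Frames ordered by rank and the five test families

rankRel : ∀ {n} → (Fin n → ℕ) → Fin n → Fin n → Bool
rankRel rk i j = rk i ≤ᵇ rk j

module RankRel {n} (rk : Fin n → ℕ) where

  rank-≤⁺ : ∀ i j → rk i ≤ rk j → T (rankRel rk i j)
  rank-≤⁺ i j = ≤⇒≤ᵇ

  rank-≤⁻ : ∀ i j → T (rankRel rk i j) → rk i ≤ rk j
  rank-≤⁻ i j = ≤ᵇ⇒≤ (rk i) (rk j)

rankRel-S4·3 : ∀ {n} (rk : Fin n → ℕ) → S4·3Frame (boolFrame n (rankRel rk))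
rankRel-S4·3 rk =
  (λ x → rank-≤⁺ x x ≤-refl) ,
  (λ x y z xy yz → rank-≤⁺ x z (≤-trans (rank-≤⁻ x y xy) (rank-≤⁻ y z yz))) ,
  λ { x y (¬xy , ¬yx) → ¬xy (rank-≤⁺ x y (≰⇒≥ (¬yx ∘ rank-≤⁺ y x))) }
  where open RankRel rk

-- In a sandwich, point 0 lies below the cluster or in it, point 1 above it or in
-- it, and all other points are in it.
data Family : Set where
  chain    : Family
  sandwich : (below above : Bool) → Family

rank : Family → ∀ {n} → Fin n → ℕ
rank chain                i             = toℕ i
rank (sandwich b a)       zero          = if b then 0 else 1
rank (sandwich b a)       (suc zero)    = if a then 2 else 1
rank (sandwich b a)       (suc (suc _)) = 1

-- Starting at three points guarantees that a sandwich has both optional extremes and a point 2 that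
-- is always in the cluster.
familyFrame : Family → ℕ → Frame
familyFrame f N = boolFrame (3 + N) (rankRel (rank f))

-- This identifies a family member, with one point other than 0 and 1 deleted, with the preceding
-- member.
rank-punchIn : ∀ f {N} (p : Fin (2 + N)) (x y : Fin (3 + N)) →
  T (rankRel (rank f) (punchIn (suc (suc p)) x) (punchIn (suc (suc p)) y)) ⇔ T (rankRel (rank f) x y)
rank-punchIn chain p x y = mk⇔
  (λ xy → ≤⇒≤ᵇ (punchIn-cancel-≤ (suc (suc p)) x y (≤ᵇ⇒≤ _ _ xy)))
  (λ xy → ≤⇒≤ᵇ (punchIn-mono-≤ (suc (suc p)) x y (≤ᵇ⇒≤ _ _ xy)))
rank-punchIn f@(sandwich b a) p x y = ≡⇒T⇔ (cong₂ _≤ᵇ_ (same x) (same y))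
  where
  same : ∀ x → rank f (punchIn (suc (suc p)) x) ≡ rank f x
  same zero          = refl
  same (suc zero)    = refl
  same (suc (suc x)) = refl

family-deletion : ∀ f φ {N} → modalities φ ≤ N →
  ValidIn (familyFrame f N) φ → ValidIn (familyFrame f (suc N)) φ
family-deletion f φ {N} φ≤N valid V w with fresh-element points short
  where
  r = rankRel (rank f)
  S4·3 = rankRel-S4·3 (rank f)
  points = w ∷ zero ∷ suc zero ∷ critical r S4·3 V φ
  -- The evaluation point, the points 0 and 1 and the critical points are kept: at most 3 + N of the
  -- 4 + N points.
  short : length points < 4 + N
  short = +-monoʳ-≤ 4 (≤-trans (length-critical r S4·3 V φ) φ≤N)
... | zero        , p∉ = contradiction (there (here refl)) p∉
... | suc zero    , p∉ = contradiction (there (there (here refl))) p∉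
... | suc (suc p) , p∉ = punchIn-surjective r S4·3 V p′ (λ w → sat (boolFrame _ r) V w φ)
  (λ x → from (delete-noncritical r S4·3 V p′ φ (p∉ ∘ there ∘ there ∘ there) x)
    (from (bisimulation-invariance bisim φ (λ { _ refl → ⇔-id _ }) refl) (valid _ x)))
  w λ { refl → p∉ (here refl) }
  where
  r = rankRel (rank f)
  S4·3 = rankRel-S4·3 (rank f)
  p′ = suc (suc p)
  bisim : Bisimulation (boolFrame _ λ x y → r (punchIn p′ x) (punchIn p′ y)) (familyFrame f N) _≡_
  bisim = record
    { forth  = λ { refl xy → return (_ , to (rank-punchIn f p _ _) xy , refl) }
    ; back   = λ { refl xy → return (_ , from (rank-punchIn f p _ _) xy , refl) }
    ; forth⁻ = λ { refl xy → return (_ , to (rank-punchIn f p _ _) xy , refl) }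
    ; back⁻  = λ { refl xy → return (_ , from (rank-punchIn f p _ _) xy , refl) }
    }

ValidInFamily RefutedInFamily : Fm → Family → Set
ValidInFamily φ f   = ∀ N → ValidIn (familyFrame f N) φ
RefutedInFamily φ f = ∃[ N ] ¬ ValidIn (familyFrame f N) φ

-- From N = `modalities φ` on, deletion carries validity from each member to the next, so testing
-- the members up to that index decides the whole family.
family-decision : ∀ φ f → ValidInFamily φ f ⊎ RefutedInFamily φ f
family-decision φ f with anyUpTo? (λ N → ¬? (valid? (3 + N) (rankRel (rank f)) φ)) (suc (modalities φ))
... | yes (N , _ , refuted) = inj₂ (N , refuted)
... | no ¬refuted           = inj₁ valid
  where
  small : ∀ {N} → N ≤ modalities φ → ValidIn (familyFrame f N) φ
  small {N} N≤ = decidable-stable (valid? _ _ φ) λ ¬valid → ¬refuted (N , s≤s N≤ , ¬valid)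
  valid : ∀ N → ValidIn (familyFrame f N) φ
  valid zero = small z≤n
  valid (suc N) with ≤-total (modalities φ) N
  ... | inj₁ φ≤N = family-deletion f φ φ≤N (valid N)
  ... | inj₂ N≤φ with m≤n⇒m<n∨m≡n N≤φ
  ...   | inj₁ N<φ  = small N<φ
  ...   | inj₂ refl = family-deletion f φ ≤-refl (valid N)

families-decision : ∀ φ → (∃[ f ] ValidInFamily φ f) ⊎ (∀ f → RefutedInFamily φ f)
families-decision φ
  with family-decision φ chain
     | family-decision φ (sandwich false false) | family-decision φ (sandwich false true)
     | family-decision φ (sandwich true false)  | family-decision φ (sandwich true true)
... | inj₁ v | _ | _ | _ | _ = inj₁ (chain , v)
... | _ | inj₁ v | _ | _ | _ = inj₁ (sandwich false false , v)
... | _ | _ | inj₁ v | _ | _ = inj₁ (sandwich false true , v)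
... | _ | _ | _ | inj₁ v | _ = inj₁ (sandwich true false , v)
... | _ | _ | _ | _ | inj₁ v = inj₁ (sandwich true true , v)
... | inj₂ c | inj₂ ff | inj₂ ft | inj₂ tf | inj₂ t2 = inj₂ λ where
  chain                  → c
  (sandwich false false) → ff
  (sandwich false true)  → ft
  (sandwich true  false) → tf
  (sandwich true  true)  → t2

-- Formulas bounding the number of points

-- first i says p_i ∧ ¬ p_j for all j < i; fewer-than m then refutes the
-- existence of m points, pairwise distinct, witnessing first 0, …, first (m - 1).
earlier : ℕ → Fm
earlier zero    = ⊥′
earlier (suc i) = ¬′ (var i) ⇒ earlier i

first : ℕ → Fm
first i = ¬′ (var i ⇒ earlier i)

-- Classically ◇ χ ∨ 𝐏 χ. Its truth yields a witness in any frame; in a linear frame any witness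
-- makes it true.
somewhere : Fm → Fm
somewhere χ = □ (¬′ χ) ⇒ 𝐏 χ

fewer-than : ℕ → Fm
fewer-than zero    = ⊥′
fewer-than (suc i) = somewhere (first i) ⇒ fewer-than i

module _ {F : Frame} {V : Valuation F} where

  earlier-intro : ∀ {i j w} → j < i → T (V j w) → sat F V w (earlier i)
  earlier-intro {suc i} (s≤s j≤i) Vj ¬Vi with m≤n⇒m<n∨m≡n j≤i
  ... | inj₁ j<i  = earlier-intro j<i Vj
  ... | inj₂ refl = contradiction Vj ¬Vi

  earlier-elim : ∀ i {w} → sat F V w (earlier i) → ¬ (∀ j → j < i → ¬ T (V j w))
  earlier-elim (suc i) e none = earlier-elim i (e (none i ≤-refl)) λ j j<i → none j (m<n⇒m<1+n j<i)

  somewhere-elim : ∀ {χ w} → sat F V w (somewhere χ) → ¬ ¬ (∃[ x ] sat F V x χ)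
  somewhere-elim s k = s (λ v _ χ-at-v → k (v , χ-at-v)) λ v _ χ-at-v → k (v , χ-at-v)

  somewhere-intro : ∀ {χ w x} → Linear F → sat F V x χ → sat F V w (somewhere χ)
  somewhere-intro {w = w} {x} lin χ-at-x □¬χ k =
    lin w x ((λ wx → □¬χ x wx χ-at-x) , (λ xw → k x xw χ-at-x))

  fewer-than-intro : ∀ m {w} → ¬ (∀ i → i < m → ¬ ¬ (∃[ x ] sat F V x (first i))) →
    sat F V w (fewer-than m)
  fewer-than-intro zero    k = k λ _ ()
  fewer-than-intro (suc m) k s = fewer-than-intro m λ below → k λ i i≤m →
    case m≤n⇒m<n∨m≡n (≤-pred i≤m) of λ where
      (inj₁ i<m)  → below i i<m
      (inj₂ refl) → somewhere-elim {first m} s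

  fewer-than-elim : ∀ m {w} → sat F V w (fewer-than m) →
    (∀ i → i < m → sat F V w (somewhere (first i))) → ⊥
  fewer-than-elim zero    s all = s
  fewer-than-elim (suc m) s all = fewer-than-elim m (s (all m ≤-refl)) λ i i<m → all i (m<n⇒m<1+n i<m)

-- The frame is arbitrary because a frame witnessing tabularity may fail to be linear. Two of the n
-- + 1 witnesses coincide, and there the variable of the smaller index contradicts `first` of the
-- larger.
fewer-than-valid : ∀ n r → ValidIn (FinFrame n r) (fewer-than (suc n))
fewer-than-valid n r V w = fewer-than-intro (suc n) λ all →
  ¬¬-choice {suc n} (λ i → all (toℕ i) (toℕ<n i)) λ point →
    let i , j , i<j , eq = pigeonhole ≤-refl (proj₁ ∘ point)
        Vi = decidable-stable (T? (V (toℕ i) _)) λ ¬Vi → proj₂ (point i) λ Vi → contradiction Vi ¬Vi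
    in proj₂ (point j) λ _ → earlier-intro {FinFrame n r} {V} i<j (subst (T ∘ V (toℕ i)) eq Vi)

fewer-than-refuted : ∀ {n} r → S4·3Frame (boolFrame (suc n) r) → ∀ {m} → m ≤ suc n →
  ¬ ValidIn (boolFrame (suc n) r) (fewer-than m)
fewer-than-refuted {n} r (_ , _ , lin) {m} m≤ valid =
  fewer-than-elim m (valid V zero) λ i i<m → somewhere-intro {χ = first i} lin (first-at i (≤-trans i<m m≤))
  where
  V : Valuation (boolFrame (suc n) r)
  V i x = ⌊ toℕ x ≟ i ⌋
  first-at : ∀ i (i<n : i < suc n) → sat (boolFrame (suc n) r) V (fromℕ< i<n) (first i)
  first-at i i<n k = earlier-elim {boolFrame (suc n) r} {V} i (k (fromWitness (toℕ-fromℕ< i<n)))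
    λ j j<i Vj → <⇒≢ j<i (trans (sym (toWitness Vj)) (toℕ-fromℕ< i<n))

-- A frame with n points would put `fewer-than (suc n)` into the logic, while the family has a
-- member with 3 + n points that is a frame for the logic and refutes it.
family-valid⇒¬tabular : ∀ {φ} f → ValidInFamily φ f → ¬ Tabular (S4·3t⊕ φ ⊢_)
family-valid⇒¬tabular f valid (n , r , L⇔) =
  fewer-than-refuted (rankRel (rank f)) S4·3 (s≤s (m≤n+m n 2))
    (soundness S4·3 (valid n) (from (L⇔ (fewer-than (suc n))) (fewer-than-valid n r)))
  where S4·3 = rankRel-S4·3 {3 + n} (rank f)

-- Boolean combinations, reductions and definability

if-then-else′ : Fm → Fm → Fm → Fm
if-then-else′ θ α β = ¬′ ((θ ⇒ α) ⇒ ¬′ (¬′ θ ⇒ β))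

-- Up to equivalence, all Boolean combinations of Θ.
trees : List Fm → List Fm
trees []      = ⊥′ ∷ ¬′ ⊥′ ∷ []
trees (θ ∷ Θ) = cartesianProductWith (if-then-else′ θ) (trees Θ) (trees Θ)

-- Finitely many substitutions: the variables below `varBound φ` range over the Boolean combinations
-- of Θ, and all others become `⊥′`.
instances : Fm → List Fm → List Fm
instances φ Θ = map (λ δs → sub (index ⊥′ δs) φ) (vecs (trees Θ) (varBound φ))

-- Agreement on `refine Θ` amounts to one more round of the tense bisimulation game.
refine : List Fm → List Fm
refine Θ = Θ ++ map □ (trees Θ) ++ map 𝐏 (trees Θ)

-- A surjective tense p-morphism onto a finite frame, given by its graph because values and
-- witnesses are available only up to double negation.
record Reduction (G : Frame) {n} (r : Fin n → Fin n → Bool) (Z : W G → Fin n → Set) : Set where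
  field
    cover      : ∀ x → ¬ ¬ (∃[ j ] Z x j)
    functional : ∀ {x i j} → Z x i → Z x j → i ≡ j
    realized   : ∀ j → ¬ ¬ (∃[ x ] Z x j)
    monotone   : ∀ {x y i j} → Z x i → Z y j → R G x y → T (r i j)
    successor  : ∀ {x i j} → Z x i → T (r i j) → ¬ ¬ (∃[ y ] R G x y × Z y j)
    predecessor : ∀ {y i j} → Z y j → T (r i j) → ¬ ¬ (∃[ x ] R G x y × Z x i)

  bisimulation : Bisimulation G (boolFrame n r) Z
  bisimulation = record
    { forth  = λ {_} {_} {x′} z xx′ → do
        j , z′ ← cover x′
        return (j , monotone z z′ xx′ , z′)
    ; back   = successor
    ; forth⁻ = λ {_} {_} {x′} z x′x → do
        j , z′ ← cover x′
        return (j , monotone z′ z x′x , z′)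
    ; back⁻  = predecessor
    }

module Definability (F : Frame) (V : Valuation F) where

  private
    _⊨_ : W F → Fm → Set
    x ⊨ χ = sat F V x χ

  Agree : List Fm → W F → W F → Set
  Agree Θ x y = ∀ θ → θ ∈ Θ → x ⊨ θ ⇔ y ⊨ θ

  agree-refl : ∀ {Θ x} → Agree Θ x x
  agree-refl _ _ = ⇔-id _

  agree-sym : ∀ {Θ x y} → Agree Θ x y → Agree Θ y x
  agree-sym xy θ θ∈ = ⇔-sym (xy θ θ∈)

  agree-trans : ∀ {Θ x y z} → Agree Θ x y → Agree Θ y z → Agree Θ x z
  agree-trans xy yz θ θ∈ = yz θ θ∈ ⇔-∘ xy θ θ∈

  then-branch : ∀ {θ α β x} → x ⊨ θ → x ⊨ if-then-else′ θ α β ⇔ x ⊨ α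
  then-branch {α = α} {x = x} t = mk⇔
    (λ s → sat-stable F V x α λ ¬a → s λ f _ → ¬a (f t))
    (λ a k → k (λ _ → a) λ ¬t → contradiction t ¬t)

  else-branch : ∀ {θ α β x} → ¬ x ⊨ θ → x ⊨ if-then-else′ θ α β ⇔ x ⊨ β
  else-branch {β = β} {x} ¬t = mk⇔
    (λ s → sat-stable F V x β λ ¬b → s λ _ g → ¬b (g ¬t))
    (λ b k → k (λ t → contradiction t ¬t) λ _ → b)

  -- Each θ splits Q in two and becomes a node of the decision tree. At a leaf all points of Q agree
  -- on everything, so P is constant there.
  invariant⇒definable-on : ∀ Θ (Q P : W F → Set) →
    (∀ {x y} → Q x → Q y → Agree Θ x y → P x → P y) →
    ¬ ¬ (∃[ δ ] δ ∈ trees Θ × (∀ x → Q x → x ⊨ δ ⇔ (¬ ¬ P x)))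
  invariant⇒definable-on [] Q P inv = do
    no ¬∃ ← excluded-middle (∃[ x ] Q x × P x)
      where yes (x , Qx , Px) → return (_ , there (here refl) , λ _ Qy →
              mk⇔ (λ _ → return (inv Qx Qy (λ _ ()) Px)) (λ _ → id))
    return (_ , here refl , λ _ Qy → mk⇔ (λ ()) λ ¬¬Py → ¬¬Py λ Py → ¬∃ (_ , Qy , Py))
  invariant⇒definable-on (θ ∷ Θ) Q P inv = do
    α , α∈ , α⇔ ← invariant⇒definable-on Θ (λ x → Q x × x ⊨ θ) P λ (Qx , x⊨θ) (Qy , y⊨θ) xy →
      inv Qx Qy λ { _ (here refl) → mk⇔ (λ _ → y⊨θ) (λ _ → x⊨θ) ; _ (there θ∈) → xy _ θ∈ }
    β , β∈ , β⇔ ← invariant⇒definable-on Θ (λ x → Q x × ¬ x ⊨ θ) P λ (Qx , x⊭θ) (Qy , y⊭θ) xy →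
      inv Qx Qy λ { _ (here refl) → mk⇔ (λ t → contradiction t x⊭θ) (λ t → contradiction t y⊭θ)
                  ; _ (there θ∈) → xy _ θ∈ }
    return (_ , ∈-cartesianProductWith⁺ (if-then-else′ θ) α∈ β∈ , λ x Qx → mk⇔
      (λ s ¬Px → excluded-middle (x ⊨ θ) λ where
        (yes t) → to (α⇔ x (Qx , t) ⇔-∘ then-branch {θ} {α} {β} t) s ¬Px
        (no ¬t) → to (β⇔ x (Qx , ¬t) ⇔-∘ else-branch {θ} {α} {β} ¬t) s ¬Px)
      (λ ¬¬Px → sat-stable F V x (if-then-else′ θ α β) λ ¬s → excluded-middle (x ⊨ θ) λ where
        (yes t) → ¬s (from (α⇔ x (Qx , t) ⇔-∘ then-branch {θ} {α} {β} t) ¬¬Px)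
        (no ¬t) → ¬s (from (β⇔ x (Qx , ¬t) ⇔-∘ else-branch {θ} {α} {β} ¬t) ¬¬Px)))

  invariant⇒definable : ∀ Θ (P : W F → Set) → (∀ {x y} → Agree Θ x y → P x → P y) →
    ¬ ¬ (∃[ δ ] δ ∈ trees Θ × (∀ x → x ⊨ δ ⇔ (¬ ¬ P x)))
  invariant⇒definable Θ P inv = do
    δ , δ∈ , δ⇔ ← invariant⇒definable-on Θ (λ _ → ⊤) P (λ _ _ → inv)
    return (δ , δ∈ , λ x → δ⇔ x tt)

  agree-refine⇒agree : ∀ {Θ x y} → Agree (refine Θ) x y → Agree Θ x y
  agree-refine⇒agree xy θ = xy θ ∘ ∈-++⁺ˡ

  -- Let δ define disagreement with y. If no successor of x′ agreed with y, then □ δ would hold at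
  -- x′, hence at x, and y would disagree with itself.
  agree-refine-successor : ∀ Θ {x x′ y} → Agree (refine Θ) x x′ → R F x y →
    ¬ ¬ (∃[ y′ ] R F x′ y′ × Agree Θ y′ y)
  agree-refine-successor Θ {y = y} xx′ xy k =
    invariant⇒definable Θ (λ z → ¬ Agree Θ z y) (λ uv ¬uy vy → ¬uy (agree-trans uv vy))
    λ (δ , δ∈ , δ⇔) →
      to (δ⇔ y) (from (xx′ _ (∈-++⁺ʳ Θ (∈-++⁺ˡ (∈-map⁺ □ δ∈))))
        (λ y′ x′y′ → from (δ⇔ y′) (return λ y′y → k (y′ , x′y′ , y′y))) y xy)
      λ ¬yy → ¬yy agree-refl

  agree-refine-predecessor : ∀ Θ {x x′ y} → Agree (refine Θ) x x′ → R F y x →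
    ¬ ¬ (∃[ y′ ] R F y′ x′ × Agree Θ y′ y)
  agree-refine-predecessor Θ {y = y} xx′ yx k =
    invariant⇒definable Θ (λ z → Agree Θ z y) (λ uv uy → agree-trans (agree-sym uv) uy)
    λ (δ , δ∈ , δ⇔) →
      to (xx′ _ (∈-++⁺ʳ Θ (∈-++⁺ʳ (map □ (trees Θ)) (∈-map⁺ 𝐏 δ∈))))
        (λ none → none y yx (from (δ⇔ y) (return agree-refl)))
      λ y′ y′x′ s → to (δ⇔ y′) s λ y′y → k (y′ , y′x′ , y′y)

  -- A valuation on the finite frame pulls back to invariant, hence definable, sets. The defining
  -- formulas give an instance of φ that is true in the model, and the bisimulation transfers it.
  definable-reduction-valid : ∀ {φ Θ n r Z} → All (TrueIn F V) (instances φ Θ) →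
    Reduction F {n} r Z → (∀ j {x y} → Agree Θ x y → Z x j → Z y j) → ValidIn (boolFrame n r) φ
  definable-reduction-valid {φ} {Θ} {n} {r} {Z} true-instances red inv V′ j =
    sat-stable _ V′ j φ λ ¬s →
    ¬¬-choice (λ i → invariant⇒definable Θ (Colour (toℕ i)) (colour-inv (toℕ i))) λ defs →
    realized j λ (x , z) → ¬s (to
      (bisimulation-sub bisimulation φ (λ o → atoms defs (occursIn⇒< φ o)) z)
      (All.lookup true-instances (∈-map⁺ _ (∈-vecs (tabulate (proj₁ ∘ defs)) λ i →
        subst (_∈ trees Θ) (sym (lookup∘tabulate (proj₁ ∘ defs) i)) (proj₁ (proj₂ (defs i))))) x))
    where
    open Reduction red
    Colour : ℕ → W F → Set
    Colour i x = ∃[ j ] Z x j × T (V′ i j)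
    colour-inv : ∀ i {x y} → Agree Θ x y → Colour i x → Colour i y
    colour-inv i xy (j , z , Vij) = j , inv j xy z , Vij
    atoms : ∀ {k} (defs : ∀ (i : Fin k) → ∃[ δ ] δ ∈ trees Θ × (∀ x → x ⊨ δ ⇔ (¬ ¬ Colour (toℕ i) x))) →
      ∀ {i x j} → i < k → Z x j → x ⊨ index ⊥′ (tabulate (proj₁ ∘ defs)) i ⇔ T (V′ i j)
    atoms defs {i} {x} {j} i<k z =
      subst (λ i → x ⊨ index ⊥′ (tabulate (proj₁ ∘ defs)) i ⇔ T (V′ i j)) (toℕ-fromℕ< i<k)
        (subst (λ δ → x ⊨ δ ⇔ T (V′ (toℕ i′) j))
          (sym (trans (index-toℕ ⊥′ (tabulate (proj₁ ∘ defs)) i′) (lookup∘tabulate (proj₁ ∘ defs) i′)))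
          (colour⇔ ⇔-∘ proj₂ (proj₂ (defs i′)) x))
      where
      i′ = fromℕ< i<k
      colour⇔ : (¬ ¬ Colour (toℕ i′) x) ⇔ T (V′ (toℕ i′) j)
      colour⇔ = mk⇔
        (λ ¬¬c → decidable-stable (T? _) λ ¬Vj → ¬¬c λ (j′ , z′ , Vj′) →
          ¬Vj (subst (T ∘ V′ (toℕ i′)) (functional z′ z) Vj′))
        (λ Vj → return (j , z , Vj))

-- Reductions onto ranked frames

module _ {G : Frame} (linear : Linear G) {n} (rk : Fin n → ℕ)
  {Z : W G → Fin n → Set} {Cell : W G → ℕ → Set} where

  -- Between distinct ranks, linearity and the order of the cells already relate the points, so
  -- witnesses have to be supplied only within a rank.
  rank-reduction :
    (∀ {x j} → Z x j → Cell x (rk j)) →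
    (∀ {x y k l} → Cell x k → Cell y l → R G x y → k ≤ l) →
    (∀ x → ¬ ¬ (∃[ j ] Z x j)) →
    (∀ {x i j} → Z x i → Z x j → i ≡ j) →
    (∀ j → ¬ ¬ (∃[ x ] Z x j)) →
    (∀ {x i j} → Z x i → rk i ≡ rk j → ¬ ¬ (∃[ y ] R G x y × Z y j)) →
    (∀ {y i j} → Z y j → rk i ≡ rk j → ¬ ¬ (∃[ x ] R G x y × Z x i)) →
    Reduction G (rankRel rk) Z
  rank-reduction cell ordered cover functional realized same-successor same-predecessor = record
    { cover       = cover
    ; functional  = functional
    ; realized    = realized
    ; monotone    = λ {_} {_} {i} {j} z z′ xy → rank-≤⁺ i j (ordered (cell z) (cell z′) xy)
    ; successor   = successor
    ; predecessor = predecessor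
    }
    where
    open RankRel rk
    below : ∀ {x y i j} → Z x i → Z y j → rk i < rk j → ¬ ¬ R G x y
    below {x} {y} z z′ i<j ¬xy = linear x y (¬xy , λ yx → <⇒≱ i<j (ordered (cell z′) (cell z) yx))
    successor : ∀ {x i j} → Z x i → T (rankRel rk i j) → ¬ ¬ (∃[ y ] R G x y × Z y j)
    successor {i = i} {j} z ij with m≤n⇒m<n∨m≡n (rank-≤⁻ i j ij)
    ... | inj₂ i≡j = same-successor z i≡j
    ... | inj₁ i<j = do
      y , z′ ← realized j
      xy ← below z z′ i<j
      return (y , xy , z′)
    predecessor : ∀ {y i j} → Z y j → T (rankRel rk i j) → ¬ ¬ (∃[ x ] R G x y × Z x i)
    predecessor {i = i} {j} z ij with m≤n⇒m<n∨m≡n (rank-≤⁻ i j ij)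
    ... | inj₂ i≡j = same-predecessor z i≡j
    ... | inj₁ i<j = do
      x , z′ ← realized i
      xy ← below z′ z i<j
      return (x , xy , z′)

-- Sublists and the pigeonhole principle

AllPairs-resp-⊆ : {A : Set} {S : A → A → Set} → ∀ {as bs} → as ⊆ bs → AllPairs S bs → AllPairs S as
AllPairs-resp-⊆ []          []       = []
AllPairs-resp-⊆ (_ ∷ʳ s)    (_ ∷ ps) = AllPairs-resp-⊆ s ps
AllPairs-resp-⊆ (refl ∷ s) (p ∷ ps) = All-resp-⊆ s p ∷ AllPairs-resp-⊆ s ps

AllPairs-lookup-injective : {A : Set} {S : A → A → Set} → (∀ {a b} → S a b → S b a) →
  ∀ {as} → AllPairs (λ a b → ¬ S a b) as →
  ∀ i j → S (List.lookup as i) (List.lookup as j) → i ≡ j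
AllPairs-lookup-injective S-sym (p ∷ ps) zero    zero    s = refl
AllPairs-lookup-injective S-sym (p ∷ ps) zero    (suc j) s = contradiction s (All.lookup p (∈-lookup j))
AllPairs-lookup-injective S-sym (p ∷ ps) (suc i) zero    s = contradiction (S-sym s) (All.lookup p (∈-lookup i))
AllPairs-lookup-injective S-sym (p ∷ ps) (suc i) (suc j) s = cong suc (AllPairs-lookup-injective S-sym ps i j s)

split : {A : Set} {P Q : A → Set} → ∀ {as} → All (λ a → P a ⊎ Q a) as →
  ∃[ bs ] ∃[ cs ] bs ⊆ as × cs ⊆ as × All P bs × All Q cs × length as ≡ length bs + length cs
split [] = [] , [] , [] , [] , [] , [] , refl
split (inj₁ p ∷ as) =
  let bs , cs , b , c , ps , qs , eq = split as in
  _ , _ , refl ∷ b , _ ∷ʳ c , p ∷ ps , qs , cong suc eq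
split (inj₂ q ∷ as) =
  let bs , cs , b , c , ps , qs , eq = split as in
  _ , _ , _ ∷ʳ b , refl ∷ c , ps , q ∷ qs , trans (cong suc eq) (sym (+-suc (length bs) (length cs)))

-- Either the last colour occurs more than K times, or discarding it costs at most K entries and
-- leaves more than c * K entries in c colours.
many-of-one-colour : {A : Set} {C : A → ℕ → Set} → ∀ c K {as} →
  All (λ a → ∃[ k ] k < c × C a k) as → c * K < length as →
  ∃[ k ] ∃[ bs ] bs ⊆ as × All (λ a → C a k) bs × K < length bs
many-of-one-colour zero    K ((_ , () , _) ∷ _) long
many-of-one-colour {A} {C} (suc c) K colours long
  with split (All.map last-colour? colours)
  where
  last-colour? : ∀ {a} → ∃[ k ] k < suc c × C a k → C a c ⊎ (∃[ k ] k < c × C a k)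
  last-colour? (k , k≤c , Cak) with m≤n⇒m<n∨m≡n (≤-pred k≤c)
  ... | inj₁ k<c  = inj₂ (k , k<c , Cak)
  ... | inj₂ refl = inj₁ Cak
... | bs , cs , bs⊆ , cs⊆ , all-c , fewer , eq with K <? length bs
...   | yes K< = c , bs , bs⊆ , all-c , K<
...   | no K≮ =
  let k , ds , ds⊆ , all-k , K< = many-of-one-colour c K fewer
        (+-cancelˡ-< K _ _ (≤-trans long (≤-trans (≤-reflexive eq) (+-monoˡ-≤ (length cs) (≮⇒≥ K≮)))))
  in k , ds , ⊆-trans ds⊆ cs⊆ , all-k , K<

-- Bounding the number of distinguishable points

record Refinement (G : Frame) (_~_ _≋_ : W G → W G → Set) : Set where
  field
    ~-refl  : ∀ {x} → x ~ x
    ~-sym   : ∀ {x y} → x ~ y → y ~ x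
    ~-trans : ∀ {x y z} → x ~ y → y ~ z → x ~ z
    ≋-sym   : ∀ {x y} → x ≋ y → y ≋ x
    ≋⇒~     : ∀ {x y} → x ≋ y → x ~ y
    zig     : ∀ {x x′ y} → x ≋ x′ → R G x y → ¬ ¬ (∃[ y′ ] R G x′ y′ × y′ ~ y)
    zag     : ∀ {x x′ y} → x ≋ x′ → R G y x → ¬ ¬ (∃[ y′ ] R G y′ x′ × y′ ~ y)

-- Which of the four sandwiches arises depends on the model, so the bound must dominate all of them
-- at once.
boolSum : (Bool → Bool → ℕ) → ℕ
boolSum f = (f true true + f true false) + (f false true + f false false)

≤-boolSum : ∀ f b a → f b a ≤ boolSum f
≤-boolSum f true  true  = ≤-trans (m≤m+n (f true true) _) (m≤m+n _ _)
≤-boolSum f true  false = ≤-trans (m≤n+m (f true false) (f true true)) (m≤m+n _ _)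
≤-boolSum f false true  = ≤-trans (m≤m+n (f false true) _) (m≤n+m _ (f true true + f true false))
≤-boolSum f false false = ≤-trans (m≤n+m (f false false) (f false true)) (m≤n+m _ (f true true + f true false))

sandwichSize : ∀ {φ} → (∀ f → RefutedInFamily φ f) → Bool → Bool → ℕ
sandwichSize refuted b a = 3 + proj₁ (refuted (sandwich b a))

-- The factors count the up-levels, the down-levels and the classes that may share both.
classBound : ∀ {φ} → (∀ f → RefutedInFamily φ f) → ℕ
classBound {φ} refuted =
  levels * (levels * boolSum (sandwichSize {φ} refuted))
  where levels = 3 + proj₁ (refuted chain)

-- Each class w yields two upsets: U w, the points above some member of w, and
-- the complement of D w, the points below some member.  Many distinct upsets
-- give a map onto a long chain.  Many classes sharing both upsets all occur
-- cofinally and coinitially in U w ∩ D w, which therefore maps onto a large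
-- cluster, while everything below and everything above it collapses to a point.
module PointBound {G : Frame} (S4·3 : S4·3Frame G) {_~_ _≋_ : W G → W G → Set}
  (refinement : Refinement G _~_ _≋_) {φ : Fm}
  (valid : ∀ {n r Z} → Reduction G {n} r Z → (∀ j {x y} → x ≋ y → Z x j → Z y j) →
    ValidIn (boolFrame n r) φ)
  (refuted : ∀ f → RefutedInFamily φ f) where

  open Refinement refinement

  private
    reflexive = proj₁ S4·3
    transitive = proj₁ (proj₂ S4·3)
    linear = proj₂ (proj₂ S4·3)

  module Chains (u : W G → W G → Set)
    (u-upset : ∀ {w x y} → R G x y → u w x → u w y)
    (u-invariant : ∀ {w x y} → x ≋ y → u w x → u w y) where

    -- The first upset of a chain serves only to keep the bottom point outside it.
    Chain : ℕ → W G → Set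
    Chain zero    w = ∃[ y ] ¬ u w y
    Chain (suc k) w = ∃[ w′ ] Chain k w′ × ∃[ y ] u w′ y × ¬ u w y

    -- The upsets shrink along the chain and cut G into layers; the cuts are made by the upsets
    -- preceding that of w.
    Cell : ∀ k {w} → Chain k w → W G → ℕ → Set
    Cell zero    c              x j = j ≡ 0
    Cell (suc k) (w′ , c , _)   x j = (u w′ x × j ≡ suc k) ⊎ (¬ u w′ x × Cell k c x j)

    cell-≤ : ∀ k {w} (c : Chain k w) {x j} → Cell k c x j → j ≤ k
    cell-≤ zero    c           refl              = z≤n
    cell-≤ (suc k) c           (inj₁ (_ , refl)) = ≤-refl
    cell-≤ (suc k) (_ , c , _) (inj₂ (_ , z))    = m≤n⇒m≤1+n (cell-≤ k c z)

    cell-cover : ∀ k {w} (c : Chain k w) x → ¬ ¬ (∃[ j ] Cell k c x j)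
    cell-cover zero    c            x = return (0 , refl)
    cell-cover (suc k) (w′ , c , _) x = do
      no ¬ux ← excluded-middle (u w′ x)
        where yes ux → return (suc k , inj₁ (ux , refl))
      j , z ← cell-cover k c x
      return (j , inj₂ (¬ux , z))

    cell-functional : ∀ k {w} (c : Chain k w) {x i j} → Cell k c x i → Cell k c x j → i ≡ j
    cell-functional zero    c           refl              refl              = refl
    cell-functional (suc k) c           (inj₁ (_ , refl)) (inj₁ (_ , refl)) = refl
    cell-functional (suc k) c           (inj₁ (ux , _))   (inj₂ (¬ux , _))  = contradiction ux ¬ux
    cell-functional (suc k) c           (inj₂ (¬ux , _))  (inj₁ (ux , _))   = contradiction ux ¬ux
    cell-functional (suc k) (_ , c , _) (inj₂ (_ , z))    (inj₂ (_ , z′))   = cell-functional k c z z′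

    cell-ordered : ∀ k {w} (c : Chain k w) {x y i j} → Cell k c x i → Cell k c y j → R G x y → i ≤ j
    cell-ordered zero    c refl _ xy = z≤n
    cell-ordered (suc k) c (inj₁ (_ , refl)) (inj₁ (_ , refl)) xy = ≤-refl
    cell-ordered (suc k) c (inj₁ (ux , _)) (inj₂ (¬uy , _)) xy = contradiction (u-upset xy ux) ¬uy
    cell-ordered (suc k) (_ , c , _) (inj₂ (_ , z)) (inj₁ (_ , refl)) xy = m≤n⇒m≤1+n (cell-≤ k c z)
    cell-ordered (suc k) (_ , c , _) (inj₂ (_ , z)) (inj₂ (_ , z′)) xy = cell-ordered k c z z′ xy

    -- The extra `¬ u w x` drives the induction: when the chain is extended beyond w, the points
    -- found so far remain in the lower layers.
    cell-realized : ∀ k {w} (c : Chain k w) {j} → j ≤ k → ∃[ x ] Cell k c x j × ¬ u w x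
    cell-realized zero (y , ¬uy) z≤n = y , refl , ¬uy
    cell-realized (suc k) (w′ , c , y , u′y , ¬uy) j≤ with m≤n⇒m<n∨m≡n j≤
    ... | inj₂ refl = y , inj₁ (u′y , refl) , ¬uy
    ... | inj₁ j<   =
      let x , z , ¬u′x = cell-realized k c (≤-pred j<) in
      x , inj₂ (¬u′x , z) , λ ux → linear x y
        ((λ xy → ¬uy (u-upset xy ux)) , (λ yx → ¬u′x (u-upset yx u′y)))

    cell-invariant : ∀ k {w} (c : Chain k w) j {x y} → x ≋ y → Cell k c x j → Cell k c y j
    cell-invariant zero    c           j xy z = z
    cell-invariant (suc k) c           j xy (inj₁ (ux , eq)) = inj₁ (u-invariant xy ux , eq)
    cell-invariant (suc k) (_ , c , _) j xy (inj₂ (¬ux , z)) =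
      inj₂ (¬ux ∘ u-invariant (≋-sym xy) , cell-invariant k c j xy z)

    height : ℕ
    height = 2 + proj₁ (refuted chain)

    -- The layers 0 to `height` map G onto the very chain that refutes φ.
    no-long-chain : ∀ w → ¬ Chain height w
    no-long-chain w c = proj₂ (refuted chain) (valid reduction λ j → cell-invariant height c (toℕ j))
      where
      reduction : Reduction G (rankRel (rank chain)) (λ x j → Cell height c x (toℕ j))
      reduction = rank-reduction linear toℕ {Cell = Cell height c}
        id
        (cell-ordered height c)
        (λ x → do
          j , z ← cell-cover height c x
          return (fromℕ< (s≤s (cell-≤ height c z)) ,
            subst (Cell height c x) (sym (toℕ-fromℕ< (s≤s (cell-≤ height c z)))) z))
        (λ z z′ → toℕ-injective (cell-functional height c z z′))
        (λ j → let x , z , _ = cell-realized height c (≤-pred (toℕ<n j)) in return (x , z))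
        (λ {x} z eq → return (x , reflexive x , subst (Cell height c x) eq z))
        (λ {x} z eq → return (x , reflexive x , subst (Cell height c x) (sym eq) z))

    -- One more than the largest k for which some `Chain k` ends in w, and 0 if there is none.
    Level : W G → ℕ → Set
    Level w zero    = ¬ Chain zero w
    Level w (suc k) = Chain k w × ¬ Chain (suc k) w

    level-below : ∀ k w → ¬ Chain k w → ¬ ¬ (∃[ l ] l < suc k × Level w l)
    level-below zero    w ¬c = return (0 , s≤s z≤n , ¬c)
    level-below (suc k) w ¬c = do
      no ¬c′ ← excluded-middle (Chain k w)
        where yes c → return (suc k , ≤-refl , c , ¬c)
      l , l< , lev ← level-below k w ¬c′
      return (l , m<n⇒m<1+n l< , lev)

    level-exists : ∀ w → ¬ ¬ (∃[ l ] l < suc height × Level w l)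
    level-exists w = level-below height w (no-long-chain w)

    -- If y separated the two upsets, a longest chain ending in w could be continued to w′, raising
    -- the level of w′.
    same-level : ∀ {w w′ y} l → Level w l → Level w′ l → u w y → ¬ ¬ u w′ y
    same-level zero    _       ¬c′       uy ¬u′y = ¬c′ (_ , ¬u′y)
    same-level (suc l) (c , _) (_ , ¬c′) uy ¬u′y = ¬c′ (_ , c , _ , uy , ¬u′y)

  module Sandwich (below above : Bool) {N : ℕ} (s : Fin (3 + N) → W G) (U D : W G → Set)
    (s-injective : ∀ i j → s i ~ s j → i ≡ j)
    (U-intro : ∀ {x y} j → y ~ s j → R G y x → U x)
    (U-elim  : ∀ {x} j → U x → ¬ ¬ (∃[ y ] y ~ s j × R G y x))
    (U-invariant : ∀ {x y} → x ≋ y → U x → U y)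
    (D-intro : ∀ {x y} j → y ~ s j → R G x y → D x)
    (D-elim  : ∀ {x} j → D x → ¬ ¬ (∃[ y ] y ~ s j × R G x y))
    (D-invariant : ∀ {x y} → x ≋ y → D x → D y)
    (below⇔ : T below ⇔ (∃[ x ] ¬ U x))
    (above⇔ : T above ⇔ (∃[ x ] ¬ D x)) where

    private
      rk : Fin (3 + N) → ℕ
      rk = rank (sandwich below above)

      two : Fin (3 + N)
      two = suc (suc zero)

    Cell : W G → ℕ → Set
    Cell x 0 = ¬ U x
    Cell x 1 = U x × D x
    Cell x 2 = ¬ D x
    Cell x _ = ⊥

    -- Middle points in none of the classes of rank 1 are sent to `two`, which lies in the cluster
    -- of every sandwich.
    Label : W G → Fin (3 + N) → Set
    Label x j = x ~ s j ⊎ (j ≡ two × (∀ i → rk i ≡ 1 → ¬ x ~ s i))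

    Z : W G → Fin (3 + N) → Set
    Z x j = Cell x (rk j) × (rk j ≡ 1 → Label x j)

    data RankView : Fin (3 + N) → Set where
      bottom  : T below → rk zero ≡ 0 → RankView zero
      top     : T above → rk (suc zero) ≡ 2 → RankView (suc zero)
      middle  : ∀ {j} → rk j ≡ 1 → RankView j

    bottom-rank : T below → rk zero ≡ 0
    bottom-rank = if-true

    top-rank : T above → rk (suc zero) ≡ 2
    top-rank = if-true

    rankView : ∀ j → RankView j
    rankView zero with T? below
    ... | yes b = bottom b (bottom-rank b)
    ... | no ¬b = middle (if-false ¬b)
    rankView (suc zero) with T? above
    ... | yes a = top a (top-rank a)
    ... | no ¬a = middle (if-false ¬a)
    rankView (suc (suc j)) = middle refl

    extremal : ∀ {i j} → rk i ≡ rk j → rk i ≢ 1 → i ≡ j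
    extremal {i} {j} eq i≢1 with rankView i | rankView j
    ... | middle i≡1 | _          = contradiction i≡1 i≢1
    ... | bottom _ _ | bottom _ _ = refl
    ... | top _ _    | top _ _    = refl
    ... | _          | middle j≡1 = contradiction (trans eq j≡1) i≢1
    ... | bottom _ e | top _ e′   = contradiction (trans (sym e) (trans eq e′)) λ ()
    ... | top _ e    | bottom _ e′ = contradiction (trans (sym e) (trans eq e′)) λ ()

    U-self : ∀ {x} j → x ~ s j → U x
    U-self {x} j x~ = U-intro j x~ (reflexive x)

    D-self : ∀ {x} j → x ~ s j → D x
    D-self {x} j x~ = D-intro j x~ (reflexive x)

    labelled : ∀ {y} j → rk j ≡ 1 → y ~ s j → Z y j
    labelled j j≡1 y~ = subst (Cell _) (sym j≡1) (U-self j y~ , D-self j y~) , λ _ → inj₁ y~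

    cell-ordered : ∀ {x y} k l → Cell x k → Cell y l → R G x y → k ≤ l
    cell-ordered 0 l _ _ xy = z≤n
    cell-ordered 1 0 (Ux , _) ¬Uy xy = ⊥-elim (U-elim two Ux λ (z , z~ , zx) →
      ¬Uy (U-intro two z~ (transitive _ _ _ zx xy)))
    cell-ordered 1 (suc l) _ _ xy = s≤s z≤n
    -- Compare x with `s two`: if x lies above it, y is in U; if x lies below it, x is in D.
    cell-ordered {x} 2 0 ¬Dx ¬Uy xy = ⊥-elim (linear (s two) x
      ((λ sx → ¬Uy (U-intro two ~-refl (transitive _ _ _ sx xy))) , (λ xs → ¬Dx (D-intro two ~-refl xs))))
    cell-ordered 2 1 ¬Dx (_ , Dy) xy = ⊥-elim (D-elim two Dy λ (z , z~ , yz) →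
      ¬Dx (D-intro two z~ (transitive _ _ _ xy yz)))
    cell-ordered 2 (suc (suc l)) _ _ xy = s≤s (s≤s z≤n)

    cover : ∀ x → ¬ ¬ (∃[ j ] Z x j)
    cover x = do
      yes Ux ← excluded-middle (U x)
        where no ¬Ux → let e = bottom-rank (from below⇔ (x , ¬Ux)) in
                return (zero , subst (Cell x) (sym e) ¬Ux , λ e′ → contradiction (trans (sym e) e′) λ ())
      yes Dx ← excluded-middle (D x)
        where no ¬Dx → let e = top-rank (from above⇔ (x , ¬Dx)) in
                return (suc zero , subst (Cell x) (sym e) ¬Dx , λ e′ → contradiction (trans (sym e) e′) λ ())
      no none ← excluded-middle (∃[ i ] rk i ≡ 1 × x ~ s i)
        where yes (i , i≡1 , x~) → return (i , labelled i i≡1 x~)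
      return (two , (Ux , Dx) , λ _ → inj₂ (refl , λ i i≡1 x~ → none (i , i≡1 , x~)))

    label-functional : ∀ {x i j} → rk i ≡ 1 → rk j ≡ 1 → Label x i → Label x j → i ≡ j
    label-functional i≡1 j≡1 (inj₁ x~i)        (inj₁ x~j)        = s-injective _ _ (~-trans (~-sym x~i) x~j)
    label-functional i≡1 j≡1 (inj₁ x~i)        (inj₂ (_ , none)) = contradiction x~i (none _ i≡1)
    label-functional i≡1 j≡1 (inj₂ (_ , none)) (inj₁ x~j)        = contradiction x~j (none _ j≡1)
    label-functional i≡1 j≡1 (inj₂ (refl , _)) (inj₂ (refl , _)) = refl

    functional : ∀ {x i j} → Z x i → Z x j → i ≡ j
    functional {x} {i} {j} (c , l) (c′ , l′) with rk i ≟ 1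
    ... | yes i≡1 = label-functional i≡1 (trans (sym same) i≡1) (l i≡1) (l′ (trans (sym same) i≡1))
      where same = ≤-antisym (cell-ordered _ _ c c′ (reflexive x)) (cell-ordered _ _ c′ c (reflexive x))
    ... | no i≢1 = extremal same i≢1
      where same = ≤-antisym (cell-ordered _ _ c c′ (reflexive x)) (cell-ordered _ _ c′ c (reflexive x))

    realized : ∀ j → ∃[ x ] Z x j
    realized j with rankView j
    ... | middle j≡1 = s j , labelled j j≡1 ~-refl
    ... | bottom b e = let x , ¬Ux = to below⇔ b in
      x , subst (Cell x) (sym e) ¬Ux , λ e′ → contradiction (trans (sym e) e′) λ ()
    ... | top a e = let x , ¬Dx = to above⇔ a in
      x , subst (Cell x) (sym e) ¬Dx , λ e′ → contradiction (trans (sym e) e′) λ ()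

    -- Above every middle point `D-elim` finds a member of each selected class, which is what makes
    -- the middle behave as a cluster.
    same-successor : ∀ {x i j} → Z x i → rk i ≡ rk j → ¬ ¬ (∃[ y ] R G x y × Z y j)
    same-successor {x} {i} {j} z eq with rk i ≟ 1
    ... | no i≢1 with refl ← extremal {i} {j} eq i≢1 = return (x , reflexive x , z)
    ... | yes i≡1 = do
      y , y~ , xy ← D-elim j (proj₂ (subst (Cell x) i≡1 (proj₁ z)))
      return (y , xy , labelled j (trans (sym eq) i≡1) y~)

    same-predecessor : ∀ {y i j} → Z y j → rk i ≡ rk j → ¬ ¬ (∃[ x ] R G x y × Z x i)
    same-predecessor {y} {i} {j} z eq with rk i ≟ 1
    ... | no i≢1 with refl ← extremal {i} {j} eq i≢1 = return (y , reflexive y , z)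
    ... | yes i≡1 = do
      x , x~ , xy ← U-elim i (proj₁ (subst (Cell y) (trans (sym eq) i≡1) (proj₁ z)))
      return (x , xy , labelled i i≡1 x~)

    cell-invariant : ∀ k {x y} → x ≋ y → Cell x k → Cell y k
    cell-invariant 0 xy ¬Ux       = ¬Ux ∘ U-invariant (≋-sym xy)
    cell-invariant 1 xy (Ux , Dx) = U-invariant xy Ux , D-invariant xy Dx
    cell-invariant 2 xy ¬Dx       = ¬Dx ∘ D-invariant (≋-sym xy)

    label-invariant : ∀ j {x y} → x ≋ y → Label x j → Label y j
    label-invariant j xy (inj₁ x~)          = inj₁ (~-trans (~-sym (≋⇒~ xy)) x~)
    label-invariant j xy (inj₂ (eq , none)) = inj₂ (eq , λ i i≡1 y~ → none i i≡1 (~-trans (≋⇒~ xy) y~))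

    sandwich-valid : ValidIn (familyFrame (sandwich below above) N) φ
    sandwich-valid = valid
      (rank-reduction linear rk {Z} {Cell} proj₁ (cell-ordered _ _) cover functional
        (λ j → return (realized j)) same-successor same-predecessor)
      (λ j xy (c , l) → cell-invariant (rk j) xy c , λ e → label-invariant j xy (l e))

  U D : W G → W G → Set
  U w x = ¬ ¬ (∃[ y ] y ~ w × R G y x)
  D w x = ¬ ¬ (∃[ y ] y ~ w × R G x y)

  U-upset : ∀ {w x y} → R G x y → U w x → U w y
  U-upset xy = ¬¬-map λ (z , z~ , zx) → z , z~ , transitive _ _ _ zx xy

  ¬D-upset : ∀ {w x y} → R G x y → ¬ D w x → ¬ D w y
  ¬D-upset xy ¬Dx Dy = ¬Dx (¬¬-map (λ (z , z~ , yz) → z , z~ , transitive _ _ _ xy yz) Dy)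

  -- Membership looks one step ahead to `~`-classes, so its invariance is under `≋`, which matches
  -- steps up to `~`.
  U-invariant : ∀ {w x y} → x ≋ y → U w x → U w y
  U-invariant xy Ux = do
    z , z~ , zx ← Ux
    z′ , z′y , z′~z ← zag xy zx
    return (z′ , ~-trans z′~z z~ , z′y)

  D-invariant : ∀ {w x y} → x ≋ y → D w x → D w y
  D-invariant xy Dx = do
    z , z~ , xz ← Dx
    z′ , yz′ , z′~z ← zig xy xz
    return (z′ , ~-trans z′~z z~ , yz′)

  module Up   = Chains U U-upset U-invariant
  module Down = Chains (λ w x → ¬ D w x) ¬D-upset (λ xy ¬Dx → ¬Dx ∘ D-invariant (≋-sym xy))

  classes : ℕ
  classes = classBound {φ} refuted

  bounded : ∀ {ws} → AllPairs (λ x y → ¬ x ~ y) ws → ¬ classes < length ws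
  bounded {ws} distinct long =
    ¬¬-All Up.level-exists ws λ levels →
    let k , ws₁ , ws₁⊆ , up , long₁ = many-of-one-colour _ _ levels long in
    ¬¬-All Down.level-exists ws₁ λ levels₁ →
    let l , ws₂ , ws₂⊆ , down , long₂ = many-of-one-colour _ _ levels₁ long₁ in
    dense {ws₂} (AllPairs-resp-⊆ (⊆-trans ws₂⊆ ws₁⊆) distinct) (All-resp-⊆ ws₂⊆ up) down long₂
    where
    dense : ∀ {ws k l} → AllPairs (λ x y → ¬ x ~ y) ws → All (λ w → Up.Level w k) ws →
      All (λ w → Down.Level w l) ws → ¬ boolSum (sandwichSize {φ} refuted) < length ws
    dense {[]} _ _ _ ()
    dense {w ∷ ws} {k} {l} distinct up down long =
      -- Points outside `U w` and outside `D w` decide which sandwich is used. Equal levels let any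
      -- listed class take the place of w in both sets.
      excluded-middle (∃[ x ] ¬ U w x) λ b → excluded-middle (∃[ x ] ¬ D w x) λ a →
      let fits = ≤-trans (≤-boolSum (sandwichSize {φ} refuted) ⌊ b ⌋ ⌊ a ⌋) (<⇒≤ long)
          s j = List.lookup (w ∷ ws) (inject≤ j fits)
          up-s j = All.lookup up (∈-lookup (inject≤ j fits))
          down-s j = All.lookup down (∈-lookup (inject≤ j fits))
          open Sandwich ⌊ b ⌋ ⌊ a ⌋ {proj₁ (refuted (sandwich ⌊ b ⌋ ⌊ a ⌋))} s (U w) (D w)
            (λ i j i~j → inject≤-injective fits fits i j
              (AllPairs-lookup-injective {S = _~_} ~-sym distinct _ _ i~j))
            (λ {x} {y} j y~ yx → stable (Up.same-level {s j} {w} {x} k (up-s j) (All.head up)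
              (return (y , y~ , yx))))
            (λ {x} j Ux → stable (Up.same-level {w} {s j} {x} k (All.head up) (up-s j) Ux))
            U-invariant
            (λ {x} {y} j y~ xy → stable λ ¬Dx → Down.same-level {w} {s j} {x} l (All.head down) (down-s j) ¬Dx
              λ ¬Dsx → ¬Dsx (return (y , y~ , xy)))
            (λ {x} j Dx → stable λ ¬Dsx → Down.same-level {s j} {w} {x} l (down-s j) (All.head down) ¬Dsx
              λ ¬Dx → ¬Dx Dx)
            D-invariant
            (mk⇔ toWitness fromWitness)
            (mk⇔ toWitness fromWitness)
      in proj₂ (refuted (sandwich ⌊ b ⌋ ⌊ a ⌋)) sandwich-valid
      where
      stable : {A : Set} → ¬ ¬ ¬ ¬ A → ¬ ¬ A
      stable = negated-stable

-- Stabilization and the finite quotient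

reduction-S4·3 : ∀ {F n r Z} → S4·3Frame F → Reduction F {n} r Z → S4·3Frame (boolFrame n r)
reduction-S4·3 {F} {n} {r} (rfl , tra , lin) red =
  (λ i → decidable-stable (T? (r i i)) do
    x , z ← realized i
    return (monotone z z (rfl x))) ,
  (λ i j k ij jk → decidable-stable (T? (r i k)) do
    x , z ← realized i
    y , xy , z′ ← successor z ij
    w , yw , z″ ← successor z′ jk
    return (monotone z z″ (tra x y w xy yw))) ,
  λ { i j (¬ij , ¬ji) → realized i λ (x , z) → realized j λ (y , z′) →
    lin x y ((¬ij ∘ monotone z z′) , (¬ji ∘ monotone z′ z)) }
  where open Reduction red

-- The Boolean combinations of stage d are, up to equivalence, the formulas of modal depth at most d
-- in the variables below `varBound ψ`.
stage : Fm → ℕ → List Fm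
stage ψ zero    = map var (upTo (varBound ψ))
stage ψ (suc d) = refine (stage ψ d)

-- The search reaches depths up to 1 + bound, and bounding the classes at depth d uses sets
-- definable at depth d + 1; hence the instances at stage 2 + bound.
module Quotient {φ ψ : Fm} (refuted : ∀ f → RefutedInFamily φ f)
  {F : Frame} (S4·3 : S4·3Frame F) {V : Valuation F}
  (instances-true : All (TrueIn F V) (instances φ (stage ψ (2 + classBound {φ} refuted))))
  (small-valid : ∀ n M → n ≤ classBound {φ} refuted → S4·3Frame (frameOf (n , M)) →
    ValidIn (frameOf (n , M)) φ → ValidIn (frameOf (n , M)) ψ) where

  open Definability F V

  bound : ℕ
  bound = classBound {φ} refuted

  infix 4 _~[_]_

  _~[_]_ : W F → ℕ → W F → Set
  x ~[ d ] y = Agree (stage ψ d) x y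

  coarsen : ∀ d e → d ≤ e → ∀ {x y} → x ~[ e ] y → x ~[ d ] y
  coarsen d zero    z≤n xy = xy
  coarsen d (suc e) d≤ xy with m≤n⇒m<n∨m≡n d≤
  ... | inj₁ d<   = coarsen d e (≤-pred d<) (agree-refine⇒agree xy)
  ... | inj₂ refl = xy

  Distinct : ℕ → List (W F) → Set
  Distinct d = AllPairs λ x y → ¬ x ~[ d ] y

  invariant-valid : ∀ d {n r Z} → d ≤ 2 + bound → Reduction F {n} r Z →
    (∀ j {x y} → x ~[ d ] y → Z x j → Z y j) → ValidIn (boolFrame n r) φ
  invariant-valid d d≤ red inv =
    definable-reduction-valid {φ} {stage ψ (2 + bound)} instances-true red λ j → inv j ∘ coarsen d (2 + bound) d≤

  distinct-bounded : ∀ {d ws} → d ≤ suc bound → Distinct d ws → length ws ≤ bound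
  distinct-bounded {d} d≤ distinct = ≮⇒≥ (PointBound.bounded S4·3
    (record
      { ~-refl  = agree-refl
      ; ~-sym   = agree-sym
      ; ~-trans = agree-trans
      ; ≋-sym   = agree-sym
      ; ≋⇒~     = agree-refine⇒agree
      ; zig     = agree-refine-successor (stage ψ d)
      ; zag     = agree-refine-predecessor (stage ψ d)
      })
    {φ} (invariant-valid (suc d) (s≤s d≤)) refuted distinct)

  distinct-injective : ∀ d {ws} → Distinct d ws → ∀ i j →
    List.lookup ws i ~[ d ] List.lookup ws j → i ≡ j
  distinct-injective d = AllPairs-lookup-injective {S = _~[ d ]_} agree-sym

  Stabilized : ℕ → Set
  Stabilized d = ∀ {x y} → x ~[ d ] y → ¬ ¬ (x ~[ suc d ] y)

  Covered : ℕ → List (W F) → Set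
  Covered d ws = ∀ x → ¬ ¬ (∃[ i ] x ~[ d ] List.lookup ws i)

  -- A stabilized agreement relation is itself a tense bisimulation, so filtration through it is a
  -- reduction. The quotient validates φ, being definable, and is small, so it validates ψ, which
  -- pulls back to the model.
  quotient : ∀ {d ws} → d ≤ suc bound → Distinct d ws → Covered d ws → Stabilized d →
    ¬ ¬ (TrueIn F V ψ)
  quotient {d} {ws} d≤ distinct covered stabilized = do
    -- The quotient has finitely many pairs of points, so all edges can be decided at once inside
    -- the monad, giving a Boolean matrix.
    edge? ← ¬¬-choice λ i → ¬¬-choice λ j → excluded-middle (Edge i j)
    let M = matrix λ i j → ⌊ edge? i j ⌋
        edge⇔ = λ i j → mk⇔ toWitness fromWitness ⇔-∘ ≡⇒T⇔ (entry-matrix (λ i j → ⌊ edge? i j ⌋) i j)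
        red = reduction M edge⇔
    return λ x → sat-stable F V x ψ λ ¬s → covered x λ (j , z) → ¬s (from
      (bisimulation-invariance (Reduction.bisimulation red) ψ atoms z)
      (small-valid _ M (distinct-bounded d≤ distinct) (reduction-S4·3 S4·3 red)
        (invariant-valid d (m≤n⇒m≤1+n d≤) red λ j xy → agree-trans (agree-sym xy))
        (λ i j → V i (point j)) j))
    where
    point = List.lookup ws
    Edge : Fin (length ws) → Fin (length ws) → Set
    Edge i j = ∃[ v ] R F (point i) v × v ~[ d ] point j
    atoms : ∀ {i x j} → i occursIn ψ → x ~[ d ] point j → T (V i x) ⇔ T (V i (point j))
    atoms o z = coarsen 0 d z≤n z _ (∈-map⁺ var (∈-upTo⁺ (occursIn⇒< ψ o)))
    reduction : ∀ M → (∀ i j → T (entry M i j) ⇔ Edge i j) →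
      Reduction F (entry M) (λ x j → x ~[ d ] point j)
    reduction M edge⇔ = record
      { cover       = covered
      ; functional  = λ z z′ → distinct-injective d distinct _ _ (agree-trans (agree-sym z) z′)
      ; realized    = λ j → return (point j , agree-refl)
      ; monotone    = λ {x} {y} {i} {j} z z′ xy → decidable-stable (T? (entry M i j)) do
          xi ← stabilized z
          v , iv , vy ← agree-refine-successor (stage ψ d) xi xy
          return (from (edge⇔ i j) (v , iv , agree-trans vy z′))
      ; successor   = λ {x} {i} {j} z ij → do
          let v , iv , vj = to (edge⇔ i j) ij
          ix ← stabilized (agree-sym z)
          y , xy , yv ← agree-refine-successor (stage ψ d) ix iv
          return (y , xy , agree-trans yv vj)
      ; predecessor = λ {y} {i} {j} z ij → do
          let v , iv , vj = to (edge⇔ i j) ij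
          vy ← stabilized (agree-trans vj (agree-sym z))
          agree-refine-predecessor (stage ψ d) vy iv
      }

  -- Each round adds a point to a list of pairwise distinguishable points, so
  -- the number of rounds is bounded and so is the modal depth d reached.
  search : ∀ fuel d ws → fuel + length ws ≡ suc bound → d ≤ length ws → Distinct d ws →
    ¬ ¬ (TrueIn F V ψ)
  -- Without fuel the list has 1 + bound distinguishable points, one too many.
  search zero d ws eq d≤ distinct =
    contradiction (≤-trans (≤-reflexive (sym eq)) (distinct-bounded (≤-trans d≤ (≤-reflexive eq)) distinct)) 1+n≰n
  search (suc fuel) d ws eq d≤ distinct = do
    no ¬new ← excluded-middle (∃[ x ] New d x)
      where yes (x , new) → search fuel d (x ∷ ws) eq′ (m≤n⇒m≤1+n d≤) (new ∷ distinct)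
    no ¬split ← excluded-middle (∃[ x ] ∃[ y ] x ~[ d ] y × ¬ x ~[ suc d ] y)
      where
      yes (x , y , xy , ¬xy) → do
        no ¬x-new ← excluded-middle (New (suc d) x)
          where yes new → search fuel (suc d) (x ∷ ws) eq′ (s≤s d≤) (new ∷ distinct′)
        no ¬y-new ← excluded-middle (New (suc d) y)
          where yes new → search fuel (suc d) (y ∷ ws) eq′ (s≤s d≤) (new ∷ distinct′)
        i , xi ← near (suc d) ¬x-new
        j , yj ← near (suc d) ¬y-new
        -- Since x and y agree at depth d, their representatives coincide; both then agree with it
        -- at depth d + 1, contrary to their choice.
        let i≡j = distinct-injective d distinct i j
              (agree-trans (agree-sym (agree-refine⇒agree xi)) (agree-trans xy (agree-refine⇒agree yj)))
        contradiction
          (agree-trans (subst (λ i → x ~[ suc d ] List.lookup ws i) i≡j xi) (agree-sym yj)) ¬xy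
    quotient (≤-trans d≤ (≤-trans (m≤n+m _ (suc fuel)) (≤-reflexive eq))) distinct
      (λ x → near d λ new → ¬new (x , new))
      (λ xy ¬xy → ¬split (_ , _ , xy , ¬xy))
    where
    New : ℕ → W F → Set
    New d x = All (λ w → ¬ x ~[ d ] w) ws
    near : ∀ d {x} → ¬ New d x → ¬ ¬ (∃[ i ] x ~[ d ] List.lookup ws i)
    near d {x} ¬new k = ¬new (All.tabulate λ w∈ xw →
      k (Any.index w∈ , subst (x ~[ d ]_) (lookup-index w∈) xw))
    distinct′ : Distinct (suc d) ws
    distinct′ = AllPairs.map (λ ¬xy → ¬xy ∘ agree-refine⇒agree) distinct
    eq′ : fuel + suc (length ws) ≡ suc bound
    eq′ = trans (+-suc fuel (length ws)) eq

  ψ-true : TrueIn F V ψ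
  ψ-true x = sat-stable F V x ψ λ ¬s →
    search (suc bound) 0 [] (+-identityʳ (suc bound)) z≤n [] λ ψ-true → ¬s (ψ-true x)

-- The characterizing finite frame and the decision

module _ (φ : Fm) (refuted : ∀ f → RefutedInFamily φ f) where

  private
    bound = classBound {φ} refuted

  ofSize : ℕ → List SquareMatrix
  ofSize n = map (n ,_) (matrices n n)

  squareMatrices : List SquareMatrix
  squareMatrices = concatMap ofSize (upTo (suc bound))

  component? : ∀ M → Dec (S4·3Frame (frameOf M) × ValidIn (frameOf M) φ)
  component? (n , M) = S4·3Frame? n (entry M) ×-dec valid? n (entry M) φ

  components : List SquareMatrix
  components = filter component? squareMatrices

  ∈-components : ∀ n M → n ≤ bound → S4·3Frame (frameOf (n , M)) →
    ValidIn (frameOf (n , M)) φ → (n , M) ∈ components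
  ∈-components n M n≤ S4·3 valid = ∈-filter⁺ component?
    (∈-concat⁺′ (∈-map⁺ (n ,_) (∈-matrices M)) (∈-map⁺ ofSize (∈-upTo⁺ (s≤s n≤)))) (S4·3 , valid)

  instances-derivable : ∀ Θ → All (S4·3t⊕ φ ⊢_) (instances φ Θ)
  instances-derivable Θ = map⁺ (All.tabulate λ {δs} _ → usub (index ⊥′ δs) ax)

  -- Soundness is applied to each component separately, since their union is in general not linear.
  refuted⇒tabular : Tabular (S4·3t⊕ φ ⊢_)
  refuted⇒tabular = unionSize components , (λ i j → T (unionRel components i j)) , λ ψ → mk⇔
    (λ d → from (union-valid components ψ)
      (All.map (λ (S4·3 , valid) → soundness S4·3 valid d) (all-filter component? squareMatrices)))
    (λ valid → derive _ (instances-derivable (stage ψ (2 + bound))) λ F S4·3 V true →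
      Quotient.ψ-true {φ} {ψ} refuted S4·3 true λ n M n≤ S4·3′ φ-valid →
        All.lookup (to (union-valid components ψ) valid) (∈-components n M n≤ S4·3′ φ-valid))

theorem6p12 : (φ : Fm) → Dec (Tabular (S4·3t⊕ φ ⊢_))
theorem6p12 φ with families-decision φ
... | inj₁ (f , valid) = no (family-valid⇒¬tabular f valid)
... | inj₂ refuted     = yes (refuted⇒tabular φ refuted)
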